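{- $$Z(1) = \Lambda^{\mathrm{bal}}_{\mathrm{odd}} \setminus \bigcup_{m>0} B\bigl(p^m\Lambda^{\mathrm{bal}}_{\mathrm{odd}},\, p^m\bigr).$$
   Context: Let $p$ be a prime, $\mathbb{F}=\mathbb{F}_p$, $S=\mathbb{F}[x,y]$, $\mathrm{Der}_S = S\partial_x\oplus S\partial_y$. Let $\mathcal{A}=\{H_1,H_2,H_3\}$ with $H_1=\ker x$, $H_2=\ker y$, $H_3=\ker(x+y)$, $\alpha_1=x,\alpha_2=y,\alpha_3=x+y$. For $\mu=(\mu_1,\mu_2,\mu_3)\in\Lambda\coloneqq\mathbb{Z}_{\ge0}^3$, $D(\mathcal{A},\mu)=\{\theta\in\mathrm{Der}_S:\theta(\alpha_i)\in\alpha_i^{\mu_i}S,\ i=1,2,3\}$; it is free of rank 2 with a homogeneous basis whose degrees (the exponents) are unique up to order and sum to $|\mu|=\mu_1+\mu_2+\mu_3$; $\Delta(\mu)$ denotes the absolute difference of the two exponents. $\mu$ is balanced if $\mu_i\le|\mu|/2$ for all $i$; $\Lambda^{\mathrm{bal}}$ is the set of balanced elements, $\Lambda_{>0}=\{\mu:\Delta(\mu)>0\}$, $\Lambda^{\mathrm{bal}}_{>0}=\Lambda^{\mathrm{bal}}\cap\Lambda_{>0}$, $\Lambda^{\mathrm{bal}}_{\mathrm{odd}}=\{\mu\in\Lambda^{\mathrm{bal}}:|\mu|\text{ odd}\}$. Two elements $\mu,\nu\in\Lambda$ are adjacent if $\mu-\nu=\pm\mathbf{e}_i$ for some $i$; connected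 components of $\Lambda_{>0}$ are the equivalence classes of the equivalence relation on $\Lambda_{>0}$ generated by adjacency. $B(\zeta,r)=\{\mu\in\Lambda:|\mu-\zeta|<r\}$, $B(T,r)=\bigcup_{\zeta\in T}B(\zeta,r)$, $cT=\{c\nu:\nu\in T\}$. It is known (Abe–Numata) that $\Lambda^{\mathrm{bal}}_{>0}$ is a union of connected components of $\Lambda_{>0}$ (the connected components of $\Lambda^{\mathrm{bal}}_{>0}$), and each such component $C$ equals $B(\zeta,\Delta(\zeta))$ for a unique $\zeta\in C$, its center, characterized as the unique element of $C$ with $\Delta(\zeta)>\Delta(\nu)$ for every $\nu$ adjacent to $\zeta$. $Z$ is the set of centers of the connected components of $\Lambda^{\mathrm{bal}}_{>0}$, and $Z(p^k)=\{\zeta\in Z:\Delta(\zeta)=p^k\}$; in particular $Z(1)=\{\zeta\in Z:\Delta(\zeta)=1\}$. -}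

module Defs where

open import Data.Nat.Base using (ℕ; zero; suc; _+_; _*_; _∸_; _^_; _≤_; _<_; _≤ᵇ_; ∣_-_∣; NonZero; _%_)
open import Data.Nat.Primality using (Prime)
open import Data.Bool.Base using (if_then_else_)
open import Data.Fin.Base using (Fin)
open import Data.Product using (_×_; _,_; proj₁; proj₂; ∃; ∃-syntax; Σ-syntax)
open import Data.Sum using (_⊎_)
open import Relation.Binary.PropositionalEquality using (_≡_)
open import Relation.Nullary using (¬_)

-- Homogeneous polynomials of F_p[x,y].
-- A form of degree d is represented by a coefficient function c : ℕ → ℕ,
-- c i being the coefficient of x^i y^(d-i) (only i ≤ d is meaningful).
-- Coefficients are natural numbers read modulo p (so F = F_p).

Form : Set
Form = ℕ → ℕ

sumTo : ℕ → (ℕ → ℕ) → ℕ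
sumTo zero    f = f zero
sumTo (suc k) f = sumTo k f + f (suc k)

trunc : ℕ → Form → Form
trunc d f i = if i ≤ᵇ d then f i else 0

zeroF : Form
zeroF _ = 0

addF : Form → Form → Form
addF f g i = f i + g i

mulF : ℕ → ℕ → Form → Form → Form
mulF a b f g k = sumTo k (λ i → trunc a f i * trunc b g (k ∸ i))

EqF : (p : ℕ) → .{{NonZero p}} → ℕ → Form → Form → Set
EqF p d f g = ∀ i → i ≤ d → f i % p ≡ g i % p

xPow : ℕ → Form
xPow m i = if i ≤ᵇ m then (if m ≤ᵇ i then 1 else 0) else 0

yPow : ℕ → Form
yPow m i = if i ≤ᵇ 0 then 1 else 0

xPlusY : Form
xPlusY _ = 1

xPlusYPow : ℕ → Form
xPlusYPow zero    = λ _ → 1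
xPlusYPow (suc m) = mulF 1 m xPlusY (xPlusYPow m)

Divides : (p : ℕ) → .{{NonZero p}} → (a : ℕ) → Form → (d : ℕ) → Form → Set
Divides p a α d f =
  (Σ[ e ∈ ℕ ] Σ[ h ∈ Form ] (e + a ≡ d × EqF p d (mulF e a h α) f))
  ⊎ EqF p d f zeroF

Λ : Set
Λ = ℕ × ℕ × ℕ

μ₁ μ₂ μ₃ : Λ → ℕ
μ₁ (a , b , c) = a
μ₂ (a , b , c) = b
μ₃ (a , b , c) = c

∣_∣ : Λ → ℕ
∣ μ ∣ = μ₁ μ + μ₂ μ + μ₃ μ

-- θ = f ∂x + g ∂y, homogeneous of (polynomial) degree d : f, g forms of degree d
Der : Set
Der = Form × Form

EqD : (p : ℕ) → .{{NonZero p}} → ℕ → Der → Der → Set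
EqD p d (f , g) (f' , g') = EqF p d f f' × EqF p d g g'

zeroD : Der
zeroD = zeroF , zeroF

-- θ ∈ D(A, μ), θ homogeneous of degree d:
-- θ(x) = f ∈ x^μ₁ S, θ(y) = g ∈ y^μ₂ S, θ(x+y) = f + g ∈ (x+y)^μ₃ S
InD : (p : ℕ) → .{{NonZero p}} → Λ → ℕ → Der → Set
InD p μ d (f , g) =
  Divides p (μ₁ μ) (xPow (μ₁ μ)) d f
  × Divides p (μ₂ μ) (yPow (μ₂ μ)) d g
  × Divides p (μ₃ μ) (xPlusYPow (μ₃ μ)) d (addF f g)

-- degree-d component of a·t where t has degree dt and a has degree d - dt
-- (a is the zero form if d < dt)
term : ℕ → ℕ → Form → Form → Form
term d dt a t = if dt ≤ᵇ d then mulF (d ∸ dt) dt a t else zeroF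

combo : ℕ → ℕ → ℕ → Form → Form → Der → Der → Der
combo d d₁ d₂ a b (f₁ , g₁) (f₂ , g₂) =
  addF (term d d₁ a f₁) (term d d₂ b f₂) , addF (term d d₁ a g₁) (term d d₂ b g₂)

-- θ₁ (degree d₁), θ₂ (degree d₂) form a homogeneous S-basis of the graded
-- module D(A, μ): both lie in D(A, μ), they generate every homogeneous
-- element, and they are S-linearly independent (checked degreewise).
IsHomBasis : (p : ℕ) → .{{NonZero p}} → Λ → ℕ → ℕ → Der → Der → Set
IsHomBasis p μ d₁ d₂ θ₁ θ₂ =
  InD p μ d₁ θ₁ × InD p μ d₂ θ₂
  × (∀ d θ → InD p μ d θ →
       Σ[ a ∈ Form ] Σ[ b ∈ Form ] EqD p d (combo d d₁ d₂ a b θ₁ θ₂) θ)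
  × (∀ d a b → EqD p d (combo d d₁ d₂ a b θ₁ θ₂) zeroD →
       (d₁ ≤ d → EqF p (d ∸ d₁) a zeroF) × (d₂ ≤ d → EqF p (d ∸ d₂) b zeroF))

Exponents : (p : ℕ) → .{{NonZero p}} → Λ → ℕ → ℕ → Set
Exponents p μ d₁ d₂ = Σ[ θ₁ ∈ Der ] Σ[ θ₂ ∈ Der ] IsHomBasis p μ d₁ d₂ θ₁ θ₂

IsΔ : (p : ℕ) → .{{NonZero p}} → Λ → ℕ → Set
IsΔ p μ n = Σ[ d₁ ∈ ℕ ] Σ[ d₂ ∈ ℕ ] (Exponents p μ d₁ d₂ × n ≡ ∣ d₁ - d₂ ∣)

Balanced : Λ → Set
Balanced μ = (2 * μ₁ μ ≤ ∣ μ ∣) × (2 * μ₂ μ ≤ ∣ μ ∣) × (2 * μ₃ μ ≤ ∣ μ ∣)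

Odd : ℕ → Set
Odd n = Σ[ k ∈ ℕ ] n ≡ suc (2 * k)

BalOdd : Λ → Set
BalOdd μ = Balanced μ × Odd ∣ μ ∣

addE : Fin 3 → Λ → Λ
addE Fin.zero                (a , b , c) = suc a , b , c
addE (Fin.suc Fin.zero)      (a , b , c) = a , suc b , c
addE (Fin.suc (Fin.suc _))   (a , b , c) = a , b , suc c

Adjacent : Λ → Λ → Set
Adjacent μ ν = Σ[ i ∈ Fin 3 ] (μ ≡ addE i ν ⊎ ν ≡ addE i μ)

dist : Λ → Λ → ℕ
dist μ ν = ∣ μ₁ μ - μ₁ ν ∣ + ∣ μ₂ μ - μ₂ ν ∣ + ∣ μ₃ μ - μ₃ ν ∣

scale : ℕ → Λ → Λ
scale c (a , b , c') = c * a , c * b , c * c'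

InZ : (Λ → ℕ) → Λ → Set
InZ Δ ζ = Balanced ζ × 0 < Δ ζ × (∀ ν → Adjacent ζ ν → Δ ν < Δ ζ)

InZ1 : (Λ → ℕ) → Λ → Set
InZ1 Δ ζ = InZ Δ ζ × Δ ζ ≡ 1

InRHS : ℕ → Λ → Set
InRHS p μ = BalOdd μ ×
  ¬ (Σ[ m ∈ ℕ ] Σ[ ν ∈ Λ ] (0 < m × BalOdd ν × dist μ (scale (p ^ m) ν) < p ^ m))

{-# OPTIONS --safe #-}
-- A nonzero member of D(A, μ) of least degree d determines Δ: the 2 × 2 minor of
-- a basis is x^μ₁ y^μ₂ (x + y)^μ₃ up to a unit, so the exponents sum to ∣ μ ∣ and
-- Δ(μ) = ∣ μ ∣ − 2d. Hence Δ changes by exactly 1 along edges, and the Frobenius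
-- gives Δ(p μ) ≥ p Δ(μ).
--
-- If ∣ ν ∣ is odd then Δ(p^m ν) ≥ p^m, so by the Lipschitz property a local
-- maximum (peak) of Δ of height 1 lies outside B(p^m ν, p^m). Conversely, climb from
-- a balanced μ of odd size to a peak ζ with dist(μ, ζ) < Δ(ζ). If Δ(ζ) ≥ 2,
-- derivations of a minimal member θ at ζ land in spaces of members in which they
-- must be proportional to θ; this forces them to vanish. So θ is a p-th power,
-- whence ζ = p ν for a peak ν of height Δ(ζ) / p. By descent ζ = p^m ν with
-- Δ(ζ) = p^m and ∣ ν ∣ odd, and m = 0 unless μ lies in the ball B(ζ, p^m).
module Submission where

open import Defs
open import Algebra.Bundles using (CommutativeSemiring)
open import Data.Bool.Base using (true; false; T)
open import Data.Bool.Properties using (T-≡; ¬-not)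
open import Data.Empty using (⊥; ⊥-elim)
open import Data.Fin.Base using (Fin; zero; suc)
open import Data.Fin.Properties using (any?)
open import Data.Nat.Base
  using (ℕ; zero; suc; _+_; _*_; _∸_; _^_; _≤_; _<_; _≤ᵇ_; ∣_-_∣; NonZero; _%_;
         z≤n; s≤s; z<s; s<s; nonTrivial⇒n>1; >-nonZero)
open import Data.Nat.DivMod using (%-distribˡ-+; %-distribˡ-*; m<n⇒m%n≡m)
open import Data.Nat.Divisibility
  using (_∣_; divides; m%n≡0⇒n∣m; n∣m⇒m%n≡0; _∣?_; ∣-refl; _∣0; ∣m+n∣m⇒∣n; ∣m∸n∣n⇒∣m; n∣m*n; ∣⇒≤)
open import Data.Nat.Primality using (Prime; euclidsLemma; prime⇒nonTrivial)
open import Data.Nat.Properties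
open import Data.Nat.Tactic.RingSolver using (solve-∀)
open import Data.Product using (_×_; _,_; proj₁; proj₂; Σ-syntax)
open import Data.Sum using (_⊎_; inj₁; inj₂; [_,_]′) renaming (swap to ⊎-swap)
open import Function using (_∘_; Equivalence)
open import Level using (0ℓ)
open import Relation.Binary.Bundles using (Setoid)
open import Relation.Binary.Definitions using (tri<; tri≈; tri>)
open import Relation.Binary.PropositionalEquality
  using (_≡_; _≢_; _≗_; refl; sym; trans; cong; cong₂; subst; module ≡-Reasoning)
import Relation.Binary.Reasoning.Setoid as SetoidReasoning
open import Relation.Nullary using (¬_; Dec; yes; no)
open import Relation.Nullary.Decidable using (_⊎-dec_)

-- Convolution of coefficient sequences

-- The crux is that θ is a p-th power at a peak ζ of height at least 2. Two derivations of degree 0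
-- test this, x∂ₓ and (x + y)∂ₓ: each keeps two of the three divisibility conditions and costs at
-- most one factor of the remaining form, x + y and x respectively. Below a peak Δ and the size both
-- drop by 1, so the least degree d stays the same at ζ - eᵢ. Height at least 2 is needed there: at
-- height 1 the two exponents at ζ - eᵢ coincide and the members of degree d form a plane, not a
-- line. One derivation alone only confines the exponents of x in θ to one residue class mod p; the
-- other shows that the class is 0. After that, a coordinate of ζ prime to p would give θ, or a
-- nonzero multiple of it by a constant, an extra factor αᵢ, against the peak; a degree prime to p
-- would let θ be divided by y, against minimality. With y = 1 the conditions at x and y become an
-- order at 0 and a degree bound. The factor 1 + x is visible in neither, so the quotient of f + g
-- by (1 + x)^μ₃ has to be carried along as data.

sumTo-cong : ∀ n {f g : ℕ → ℕ} → (∀ i → i ≤ n → f i ≡ g i) → sumTo n f ≡ sumTo n g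
sumTo-cong zero    f≡g = f≡g 0 z≤n
sumTo-cong (suc n) f≡g =
  cong₂ _+_ (sumTo-cong n (λ i i≤n → f≡g i (m≤n⇒m≤1+n i≤n))) (f≡g (suc n) ≤-refl)

sumTo-suc : ∀ n f → sumTo (suc n) f ≡ f 0 + sumTo n (f ∘ suc)
sumTo-suc zero    f = refl
sumTo-suc (suc n) f =
  trans (cong (_+ f (suc (suc n))) (sumTo-suc n f)) (+-assoc (f 0) _ _)

sumTo-+ : ∀ n f g → sumTo n (λ i → f i + g i) ≡ sumTo n f + sumTo n g
sumTo-+ zero    f g = refl
sumTo-+ (suc n) f g = trans
  (cong (_+ (f (suc n) + g (suc n))) (sumTo-+ n f g)) (interchange (sumTo n f) _ _ _)
  where
  interchange : ∀ a b c d → (a + b) + (c + d) ≡ (a + c) + (b + d)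
  interchange = solve-∀

sumTo-* : ∀ n a f → sumTo n (λ i → a * f i) ≡ a * sumTo n f
sumTo-* zero    a f = refl
sumTo-* (suc n) a f = trans
  (cong (_+ a * f (suc n)) (sumTo-* n a f)) (sym (*-distribˡ-+ a (sumTo n f) _))

infixl 7 _⊛_

-- Setting y = 1 identifies forms with sequences of coefficients, and their
-- product with convolution; the degree is tracked separately.
_⊛_ : Form → Form → Form
(f ⊛ g) n = sumTo n (λ i → f i * g (n ∸ i))

const : ℕ → Form
const a zero    = a
const a (suc _) = 0

⊛-cong : ∀ {f f′ g g′} → f ≗ f′ → g ≗ g′ → f ⊛ g ≗ f′ ⊛ g′
⊛-cong f≗ g≗ n = sumTo-cong n (λ i _ → cong₂ _*_ (f≗ i) (g≗ (n ∸ i)))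

⊛-sucˡ : ∀ f g n → (f ⊛ g) (suc n) ≡ f 0 * g (suc n) + ((f ∘ suc) ⊛ g) n
⊛-sucˡ f g n = sumTo-suc n (λ i → f i * g (suc n ∸ i))

⊛-sucʳ : ∀ f g n → (f ⊛ g) (suc n) ≡ (f ⊛ (g ∘ suc)) n + f (suc n) * g 0
⊛-sucʳ f g n = cong₂ _+_
  (sumTo-cong n (λ i i≤n → cong (λ k → f i * g k) (+-∸-assoc 1 i≤n)))
  (cong (λ k → f (suc n) * g k) (n∸n≡0 n))

⊛-comm : ∀ f g → f ⊛ g ≗ g ⊛ f
⊛-comm f g zero    = *-comm (f 0) (g 0)
⊛-comm f g (suc n) = begin
  (f ⊛ g) (suc n)                       ≡⟨ ⊛-sucˡ f g n ⟩
  f 0 * g (suc n) + ((f ∘ suc) ⊛ g) n   ≡⟨ cong₂ _+_ (*-comm (f 0) _) (⊛-comm (f ∘ suc) g n) ⟩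
  g (suc n) * f 0 + (g ⊛ (f ∘ suc)) n   ≡⟨ +-comm (g (suc n) * f 0) _ ⟩
  (g ⊛ (f ∘ suc)) n + g (suc n) * f 0   ≡⟨ ⊛-sucʳ g f n ⟨
  (g ⊛ f) (suc n)                       ∎
  where open ≡-Reasoning

⊛-distribʳ : ∀ h f g → addF f g ⊛ h ≗ addF (f ⊛ h) (g ⊛ h)
⊛-distribʳ h f g n = trans
  (sumTo-cong n (λ i _ → *-distribʳ-+ (h (n ∸ i)) (f i) (g i)))
  (sumTo-+ n (λ i → f i * h (n ∸ i)) (λ i → g i * h (n ∸ i)))

⊛-scaleˡ : ∀ a f g → (λ i → a * f i) ⊛ g ≗ (λ i → a * (f ⊛ g) i)
⊛-scaleˡ a f g n = trans
  (sumTo-cong n (λ i _ → *-assoc a (f i) (g (n ∸ i))))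
  (sumTo-* n a (λ i → f i * g (n ∸ i)))

⊛-zeroˡ : ∀ f → zeroF ⊛ f ≗ zeroF
⊛-zeroˡ f n = sumTo-* n 0 (λ _ → 0)

⊛-const : ∀ a f → const a ⊛ f ≗ (λ i → a * f i)
⊛-const a f zero    = refl
⊛-const a f (suc n) = trans (⊛-sucˡ (const a) f n)
  (trans (cong (a * f (suc n) +_) (⊛-zeroˡ f n)) (+-identityʳ _))

⊛-assoc : ∀ f g h → (f ⊛ g) ⊛ h ≗ f ⊛ (g ⊛ h)
⊛-assoc f g h zero    = *-assoc (f 0) (g 0) (h 0)
⊛-assoc f g h (suc n) = begin
  ((f ⊛ g) ⊛ h) (suc n)
    ≡⟨ ⊛-sucˡ (f ⊛ g) h n ⟩
  f 0 * g 0 * h (suc n) + (((f ⊛ g) ∘ suc) ⊛ h) n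
    ≡⟨ cong (f 0 * g 0 * h (suc n) +_) (⊛-cong {g = h} (⊛-sucˡ f g) (λ _ → refl) n) ⟩
  f 0 * g 0 * h (suc n) + (addF (λ i → f 0 * g (suc i)) ((f ∘ suc) ⊛ g) ⊛ h) n
    ≡⟨ cong (f 0 * g 0 * h (suc n) +_) (⊛-distribʳ h (λ i → f 0 * g (suc i)) ((f ∘ suc) ⊛ g) n) ⟩
  f 0 * g 0 * h (suc n) + (((λ i → f 0 * g (suc i)) ⊛ h) n + (((f ∘ suc) ⊛ g) ⊛ h) n)
    ≡⟨ cong (f 0 * g 0 * h (suc n) +_)
         (cong₂ _+_ (⊛-scaleˡ (f 0) (g ∘ suc) h n) (⊛-assoc (f ∘ suc) g h n)) ⟩
  f 0 * g 0 * h (suc n) + (f 0 * ((g ∘ suc) ⊛ h) n + ((f ∘ suc) ⊛ (g ⊛ h)) n)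
    ≡⟨ regroup (f 0) (g 0) (h (suc n)) _ _ ⟩
  f 0 * (g 0 * h (suc n) + ((g ∘ suc) ⊛ h) n) + ((f ∘ suc) ⊛ (g ⊛ h)) n
    ≡⟨ cong (λ z → f 0 * z + ((f ∘ suc) ⊛ (g ⊛ h)) n) (⊛-sucˡ g h n) ⟨
  f 0 * (g ⊛ h) (suc n) + ((f ∘ suc) ⊛ (g ⊛ h)) n
    ≡⟨ ⊛-sucˡ f (g ⊛ h) n ⟨
  (f ⊛ (g ⊛ h)) (suc n) ∎
  where
  open ≡-Reasoning
  regroup : ∀ a b c d e → a * b * c + (a * d + e) ≡ a * (b * c + d) + e
  regroup = solve-∀

-- Multiplication by 1 + x, monomials and truncation

infixr 8 [1+x]_ [1+x]^_·_

-- The factor x + y at y = 1, as an operator on coefficients rather than a convolution, so that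
-- facts about order and degree are one-step inductions.
[1+x]_ : Form → Form
([1+x] f) zero    = f 0
([1+x] f) (suc n) = f n + f (suc n)

[1+x]^_·_ : ℕ → Form → Form
[1+x]^ zero  · f = f
[1+x]^ suc c · f = [1+x] ([1+x]^ c · f)

[1+x]-⊛ : ∀ f g → [1+x] (f ⊛ g) ≗ ([1+x] f) ⊛ g
[1+x]-⊛ f g zero    = refl
[1+x]-⊛ f g (suc n) = begin
  (f ⊛ g) n + (f ⊛ g) (suc n)
    ≡⟨ cong ((f ⊛ g) n +_) (⊛-sucˡ f g n) ⟩
  (f ⊛ g) n + (f 0 * g (suc n) + ((f ∘ suc) ⊛ g) n)
    ≡⟨ swap ((f ⊛ g) n) (f 0 * g (suc n)) _ ⟩
  f 0 * g (suc n) + ((f ⊛ g) n + ((f ∘ suc) ⊛ g) n)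
    ≡⟨ cong (f 0 * g (suc n) +_) (⊛-distribʳ g f (f ∘ suc) n) ⟨
  f 0 * g (suc n) + ((([1+x] f) ∘ suc) ⊛ g) n
    ≡⟨ ⊛-sucˡ ([1+x] f) g n ⟨
  (([1+x] f) ⊛ g) (suc n) ∎
  where
  open ≡-Reasoning
  swap : ∀ a b c → a + (b + c) ≡ b + (a + c)
  swap = solve-∀

[1+x]-cong-≗ : ∀ {f g} → f ≗ g → [1+x] f ≗ [1+x] g
[1+x]-cong-≗ f≗g zero    = f≗g 0
[1+x]-cong-≗ f≗g (suc n) = cong₂ _+_ (f≗g n) (f≗g (suc n))

[1+x]^-⊛ : ∀ c f g → [1+x]^ c · (f ⊛ g) ≗ ([1+x]^ c · f) ⊛ g
[1+x]^-⊛ zero    f g n = refl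
[1+x]^-⊛ (suc c) f g n = trans ([1+x]-cong-≗ ([1+x]^-⊛ c f g) n) ([1+x]-⊛ ([1+x]^ c · f) g n)

≤ᵇ-true : ∀ {m n} → m ≤ n → (m ≤ᵇ n) ≡ true
≤ᵇ-true m≤n = Equivalence.to T-≡ (≤⇒≤ᵇ m≤n)

≤ᵇ-false : ∀ {m n} → n < m → (m ≤ᵇ n) ≡ false
≤ᵇ-false {m} {n} n<m = ¬-not (λ eq → <⇒≱ n<m (≤ᵇ⇒≤ m n (Equivalence.from T-≡ eq)))

xPow-diag : ∀ a → xPow a a ≡ 1
xPow-diag a rewrite ≤ᵇ-true (≤-refl {a}) = refl

xPow-off : ∀ a i → i ≢ a → xPow a i ≡ 0
xPow-off a i i≢a with <-cmp i a
... | tri< i<a _ _ rewrite ≤ᵇ-true (<⇒≤ i<a) | ≤ᵇ-false i<a = refl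
... | tri≈ _ i≡a _ = ⊥-elim (i≢a i≡a)
... | tri> _ _ a<i rewrite ≤ᵇ-false a<i = refl

x·_ : Form → Form
(x· f) zero    = 0
(x· f) (suc n) = f n

-- In the coordinate y = 1 these are ∂ₓ, x∂ₓ and (x + y)∂ₓ.
∂ x∂ [1+x]∂ : Form → Form
∂ f i = suc i * f (suc i)
x∂ f i = i * f i
[1+x]∂ f i = i * f i + suc i * f (suc i)

trunc-≤ : ∀ d f {i} → i ≤ d → trunc d f i ≡ f i
trunc-≤ d f i≤d rewrite ≤ᵇ-true i≤d = refl

trunc-> : ∀ d f {i} → d < i → trunc d f i ≡ 0
trunc-> d f d<i rewrite ≤ᵇ-false d<i = refl

trunc-yPow : ∀ b → trunc b (yPow b) ≗ const 1
trunc-yPow b zero    = refl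
trunc-yPow b (suc i) with suc i ≤ᵇ b
... | true  = refl
... | false = refl

[1+x]^-+-exp : ∀ a b f → [1+x]^ (a + b) · f ≡ [1+x]^ a · ([1+x]^ b · f)
[1+x]^-+-exp zero    b f = refl
[1+x]^-+-exp (suc a) b f = cong [1+x]_ ([1+x]^-+-exp a b f)

-- Paths and distances in Λ

-- On the wall μᵢ = 0 this fixes μ. Derivatives of members of D(A, μ) lie in D(A, `subE i μ`) in
-- that case too.
subE : Fin 3 → Λ → Λ
subE zero             (a , b , c) = a ∸ 1 , b , c
subE (suc zero)       (a , b , c) = a , b ∸ 1 , c
subE (suc (suc zero)) (a , b , c) = a , b , c ∸ 1

subE-cases : ∀ i μ → μ ≡ addE i (subE i μ) ⊎ subE i μ ≡ μ
subE-cases zero             (zero  , b , c) = inj₂ refl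
subE-cases zero             (suc a , b , c) = inj₁ refl
subE-cases (suc zero)       (a , zero  , c) = inj₂ refl
subE-cases (suc zero)       (a , suc b , c) = inj₁ refl
subE-cases (suc (suc zero)) (a , b , zero)  = inj₂ refl
subE-cases (suc (suc zero)) (a , b , suc c) = inj₁ refl

∣addE∣ : ∀ i μ → ∣ addE i μ ∣ ≡ suc ∣ μ ∣
∣addE∣ zero             (a , b , c) = refl
∣addE∣ (suc zero)       (a , b , c) = cong (_+ c) (+-suc a b)
∣addE∣ (suc (suc zero)) (a , b , c) = +-suc (a + b) c

∣scale∣ : ∀ k μ → ∣ scale k μ ∣ ≡ k * ∣ μ ∣
∣scale∣ k (a , b , c) = distrib k a b c
  where
  distrib : ∀ k a b c → k * a + k * b + k * c ≡ k * (a + b + c)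
  distrib = solve-∀

subE-addE : ∀ i μ → subE i (addE i μ) ≡ μ
subE-addE zero             μ = refl
subE-addE (suc zero)       μ = refl
subE-addE (suc (suc zero)) μ = refl

Adjacent-sym : ∀ {μ ν} → Adjacent μ ν → Adjacent ν μ
Adjacent-sym (i , e) = i , ⊎-swap e

scale-1 : ∀ μ → scale 1 μ ≡ μ
scale-1 (a , b , c) = cong₂ _,_ (*-identityˡ a) (cong₂ _,_ (*-identityˡ b) (*-identityˡ c))

scale-* : ∀ k l μ → scale (k * l) μ ≡ scale k (scale l μ)
scale-* k l (a , b , c) = cong₂ _,_ (*-assoc k l a) (cong₂ _,_ (*-assoc k l b) (*-assoc k l c))

∣1+m-m∣≡1 : ∀ m → ∣ suc m - m ∣ ≡ 1
∣1+m-m∣≡1 zero    = refl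
∣1+m-m∣≡1 (suc m) = ∣1+m-m∣≡1 m

dist-sym : ∀ μ ν → dist μ ν ≡ dist ν μ
dist-sym (a , b , c) (a′ , b′ , c′) =
  cong₂ _+_ (cong₂ _+_ (∣-∣-comm a a′) (∣-∣-comm b b′)) (∣-∣-comm c c′)

dist-addE : ∀ i μ → dist (addE i μ) μ ≡ 1
dist-addE zero (a , b , c)
  rewrite ∣1+m-m∣≡1 a | ∣n-n∣≡0 b | ∣n-n∣≡0 c = refl
dist-addE (suc zero) (a , b , c)
  rewrite ∣n-n∣≡0 a | ∣1+m-m∣≡1 b | ∣n-n∣≡0 c = refl
dist-addE (suc (suc zero)) (a , b , c)
  rewrite ∣n-n∣≡0 a | ∣n-n∣≡0 b | ∣1+m-m∣≡1 c = refl

dist-adjacent : ∀ {μ ν} → Adjacent μ ν → dist μ ν ≡ 1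
dist-adjacent {ν = ν} (i , inj₁ refl) = dist-addE i ν
dist-adjacent {μ} (i , inj₂ refl) = trans (dist-sym μ (addE i μ)) (dist-addE i μ)

dist-triangle : ∀ μ ν τ → dist μ τ ≤ dist μ ν + dist ν τ
dist-triangle (a , b , c) (a′ , b′ , c′) (a″ , b″ , c″) = ≤-trans
  (+-mono-≤ (+-mono-≤ (∣-∣-triangle a a′ a″) (∣-∣-triangle b b′ b″)) (∣-∣-triangle c c′ c″))
  (≤-reflexive (regroup ∣ a - a′ ∣ ∣ a′ - a″ ∣ ∣ b - b′ ∣ ∣ b′ - b″ ∣ ∣ c - c′ ∣ ∣ c′ - c″ ∣))
  where
  regroup : ∀ x x′ y y′ z z′ → x + x′ + (y + y′) + (z + z′) ≡ x + y + z + (x′ + y′ + z′)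
  regroup = solve-∀

dist-scale : ∀ k μ ν → dist (scale k μ) (scale k ν) ≡ k * dist μ ν
dist-scale k (a , b , c) (a′ , b′ , c′) = trans
  (cong₂ _+_ (cong₂ _+_ (sym (*-distribˡ-∣-∣ k a a′)) (sym (*-distribˡ-∣-∣ k b b′)))
    (sym (*-distribˡ-∣-∣ k c c′)))
  (factor k ∣ a - a′ ∣ ∣ b - b′ ∣ ∣ c - c′ ∣)
  where
  factor : ∀ k x y z → k * x + k * y + k * z ≡ k * (x + y + z)
  factor = solve-∀

approach : ∀ x y → x ≡ y ⊎ ∣ x - y ∣ ≡ suc ∣ suc x - y ∣
  ⊎ Σ[ w ∈ ℕ ] (x ≡ suc w × ∣ x - y ∣ ≡ suc ∣ w - y ∣)
approach zero    zero    = inj₁ refl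
approach zero    (suc y) = inj₂ (inj₁ refl)
approach (suc x) zero    = inj₂ (inj₂ (x , refl , cong suc (sym (∣-∣-identityʳ x))))
approach (suc x) (suc y) with approach x y
... | inj₁ refl                   = inj₁ refl
... | inj₂ (inj₁ eq)              = inj₂ (inj₁ eq)
... | inj₂ (inj₂ (w , refl , eq)) = inj₂ (inj₂ (suc w , refl , eq))

step-towards : ∀ μ τ → μ ≡ τ ⊎ Σ[ ν ∈ Λ ] (Adjacent μ ν × dist μ τ ≡ suc (dist ν τ))
step-towards (a , b , c) (a′ , b′ , c′) with approach a a′
... | inj₂ (inj₁ eq) =
  inj₂ ((suc a , b , c) , (zero , inj₂ refl) , cong (λ n → n + ∣ b - b′ ∣ + ∣ c - c′ ∣) eq)
... | inj₂ (inj₂ (w , refl , eq)) =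
  inj₂ ((w , b , c) , (zero , inj₁ refl) , cong (λ n → n + ∣ b - b′ ∣ + ∣ c - c′ ∣) eq)
... | inj₁ refl with approach b b′
...   | inj₂ (inj₁ eq) =
  inj₂ ((a , suc b , c) , (suc zero , inj₂ refl) ,
    trans (cong (λ n → ∣ a - a ∣ + n + ∣ c - c′ ∣) eq)
      (cong (_+ ∣ c - c′ ∣) (+-suc ∣ a - a ∣ ∣ suc b - b′ ∣)))
...   | inj₂ (inj₂ (w , refl , eq)) =
  inj₂ ((a , w , c) , (suc zero , inj₁ refl) ,
    trans (cong (λ n → ∣ a - a ∣ + n + ∣ c - c′ ∣) eq)
      (cong (_+ ∣ c - c′ ∣) (+-suc ∣ a - a ∣ ∣ w - b′ ∣)))
...   | inj₁ refl with approach c c′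
...     | inj₁ refl = inj₁ refl
...     | inj₂ (inj₁ eq) =
  inj₂ ((a , b , suc c) , (suc (suc zero) , inj₂ refl) ,
    trans (cong (∣ a - a ∣ + ∣ b - b ∣ +_) eq) (+-suc (∣ a - a ∣ + ∣ b - b ∣) ∣ suc c - c′ ∣))
...     | inj₂ (inj₂ (w , refl , eq)) =
  inj₂ ((a , b , w) , (suc (suc zero) , inj₁ refl) ,
    trans (cong (∣ a - a ∣ + ∣ b - b ∣ +_) eq) (+-suc (∣ a - a ∣ + ∣ b - b ∣) ∣ w - c′ ∣))

-- The margin for one step: an edge changes each 2μⱼ - ∣μ∣ by exactly 1.
StrictlyBalanced : Λ → Set
StrictlyBalanced μ = 2 * μ₁ μ < ∣ μ ∣ × 2 * μ₂ μ < ∣ μ ∣ × 2 * μ₃ μ < ∣ μ ∣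

StrictlyBalanced⇒Balanced-addE : ∀ i μ → StrictlyBalanced μ → Balanced (addE i μ)
StrictlyBalanced⇒Balanced-addE i μ@(a , b , c) (sa , sb , sc) = go i
  where
  s : ℕ
  s = ∣ μ ∣
  raise : ∀ {x} → 2 * x < s → 2 * suc x ≤ suc s
  raise {x} 2x<s = ≤-trans (≤-reflexive (*-suc 2 x)) (s≤s 2x<s)
  keep : ∀ {x} → 2 * x < s → 2 * x ≤ suc s
  keep 2x<s = m≤n⇒m≤1+n (<⇒≤ 2x<s)
  go : ∀ i → Balanced (addE i μ)
  go zero             = raise {a} sa , keep {b} sb , keep {c} sc
  go (suc zero)       = subst (λ n → 2 * a ≤ n × 2 * suc b ≤ n × 2 * c ≤ n)
    (sym (∣addE∣ (suc zero) μ)) (keep {a} sa , raise {b} sb , keep {c} sc)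
  go (suc (suc zero)) = subst (λ n → 2 * a ≤ n × 2 * b ≤ n × 2 * suc c ≤ n)
    (sym (∣addE∣ (suc (suc zero)) μ)) (keep {a} sa , keep {b} sb , raise {c} sc)

StrictlyBalanced-addE⇒Balanced : ∀ i μ → StrictlyBalanced (addE i μ) → Balanced μ
StrictlyBalanced-addE⇒Balanced i μ@(a , b , c) = go i
  where
  keep : ∀ {x n} → n ≡ suc ∣ μ ∣ → 2 * x < n → 2 * x ≤ ∣ μ ∣
  keep refl 2x<1+s = ≤-pred 2x<1+s
  lower : ∀ {x n} → n ≡ suc ∣ μ ∣ → 2 * suc x < n → 2 * x ≤ ∣ μ ∣
  lower {x} eq 2+2x<n = keep {x} eq (<-trans (*-monoʳ-< 2 (n<1+n x)) 2+2x<n)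
  go : ∀ i → StrictlyBalanced (addE i μ) → Balanced μ
  go zero             (sa , sb , sc) = lower {a} refl sa , keep {b} refl sb , keep {c} refl sc
  go (suc zero)       (sa , sb , sc) = keep {a} eq sa , lower {b} eq sb , keep {c} eq sc
    where eq = ∣addE∣ (suc zero) μ
  go (suc (suc zero)) (sa , sb , sc) = keep {a} eq sa , keep {b} eq sb , lower {c} eq sc
    where eq = ∣addE∣ (suc (suc zero)) μ

-- Determinant identities in a commutative semiring with an element -1

module RingIdentities {a ℓ} (R : CommutativeSemiring a ℓ) where
  open CommutativeSemiring R
    using (Carrier; _≈_; 0#; 1#; setoid; +-congˡ; *-congʳ; zeroˡ)
    renaming (_+_ to infixl 6 _⊕_; _*_ to infixl 7 _⊗_;
              refl to ≈-refl; trans to ≈-trans; +-identityʳ to ⊕-identityʳ)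
  open import Algebra.Solver.Ring.NaturalCoefficients.Default R using (solve; _:=_; _:+_; _:*_; con)
  open SetoidReasoning setoid

  -- m plays the role of −1: the solver knows semirings only.
  module _ (m : Carrier) (1+m≈0 : 1# ⊕ m ≈ 0#) where
    -- The terms s and t balance the two sides into an identity of semirings; both enter with the
    -- factor 1 + m, which is 0.
    cancel-1+m : ∀ {A B} s t → A ⊕ (1# ⊕ m) ⊗ s ≈ B ⊕ (1# ⊕ m) ⊗ t → A ≈ B
    cancel-1+m {A} {B} s t eq = begin
      A                  ≈⟨ absorb A s ⟨
      A ⊕ (1# ⊕ m) ⊗ s   ≈⟨ eq ⟩
      B ⊕ (1# ⊕ m) ⊗ t   ≈⟨ absorb B t ⟩
      B                  ∎
      where
      absorb : ∀ A s → A ⊕ (1# ⊕ m) ⊗ s ≈ A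
      absorb A s = ≈-trans (+-congˡ (≈-trans (*-congʳ 1+m≈0) (zeroˡ s))) (⊕-identityʳ A)

    -- Multiplicativity of the 2 × 2 determinant, for the matrix of cofactors times the matrix of
    -- the fᵢ and gᵢ.
    cramer : ∀ u v u′ v′ f₁ g₁ f₂ g₂ →
      (u ⊗ f₁ ⊕ v ⊗ f₂) ⊗ (u′ ⊗ g₁ ⊕ v′ ⊗ g₂) ⊕ m ⊗ ((u′ ⊗ f₁ ⊕ v′ ⊗ f₂) ⊗ (u ⊗ g₁ ⊕ v ⊗ g₂))
        ≈ (u ⊗ v′ ⊕ m ⊗ (u′ ⊗ v)) ⊗ (f₁ ⊗ g₂ ⊕ m ⊗ (f₂ ⊗ g₁))
    cramer u v u′ v′ f₁ g₁ f₂ g₂ = cancel-1+m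
      (m ⊗ (u′ ⊗ v ⊗ f₂ ⊗ g₁)) (u ⊗ u′ ⊗ f₁ ⊗ g₁ ⊕ v ⊗ v′ ⊗ f₂ ⊗ g₂ ⊕ u′ ⊗ v ⊗ f₂ ⊗ g₁)
      (solve 9
      (λ m u v u′ v′ f₁ g₁ f₂ g₂ →
        (u :* f₁ :+ v :* f₂) :* (u′ :* g₁ :+ v′ :* g₂)
          :+ m :* ((u′ :* f₁ :+ v′ :* f₂) :* (u :* g₁ :+ v :* g₂))
          :+ (con 1 :+ m) :* (m :* (u′ :* v :* f₂ :* g₁))
        := (u :* v′ :+ m :* (u′ :* v)) :* (f₁ :* g₂ :+ m :* (f₂ :* g₁))
          :+ (con 1 :+ m) :* (u :* u′ :* f₁ :* g₁ :+ v :* v′ :* f₂ :* g₂ :+ u′ :* v :* f₂ :* g₁))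
      ≈-refl m u v u′ v′ f₁ g₁ f₂ g₂)

    -- The column operation that brings in f + g, the entry divisible by (x + y)^μ₃.
    add-column : ∀ f₁ g₁ f₂ g₂ →
      f₁ ⊗ (f₂ ⊕ g₂) ⊕ m ⊗ (f₂ ⊗ (f₁ ⊕ g₁)) ≈ f₁ ⊗ g₂ ⊕ m ⊗ (f₂ ⊗ g₁)
    add-column f₁ g₁ f₂ g₂ = cancel-1+m 0# (f₁ ⊗ f₂)
      (solve 5 (λ m f₁ g₁ f₂ g₂ →
        f₁ :* (f₂ :+ g₂) :+ m :* (f₂ :* (f₁ :+ g₁)) :+ (con 1 :+ m) :* con 0
        := f₁ :* g₂ :+ m :* (f₂ :* g₁) :+ (con 1 :+ m) :* (f₁ :* f₂))
      ≈-refl m f₁ g₁ f₂ g₂)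

    x*y-y*x≈0 : ∀ x y → x ⊗ y ⊕ m ⊗ y ⊗ x ≈ 0#
    x*y-y*x≈0 x y = cancel-1+m 0# (x ⊗ y)
      (solve 3 (λ m x y → x :* y :+ m :* y :* x :+ (con 1 :+ m) :* con 0
        := con 0 :+ (con 1 :+ m) :* (x :* y)) ≈-refl m x y)

    expand-minor-f : ∀ f₁ g₁ f₂ g₂ → g₂ ⊗ f₁ ⊕ m ⊗ g₁ ⊗ f₂ ≈ f₁ ⊗ g₂ ⊕ m ⊗ (f₂ ⊗ g₁)
    expand-minor-f f₁ g₁ f₂ g₂ = solve 5 (λ m f₁ g₁ f₂ g₂ →
        g₂ :* f₁ :+ m :* g₁ :* f₂ := f₁ :* g₂ :+ m :* (f₂ :* g₁))
      ≈-refl m f₁ g₁ f₂ g₂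

    expand-minor-g : ∀ f₁ g₁ f₂ g₂ → m ⊗ f₂ ⊗ g₁ ⊕ f₁ ⊗ g₂ ≈ f₁ ⊗ g₂ ⊕ m ⊗ (f₂ ⊗ g₁)
    expand-minor-g f₁ g₁ f₂ g₂ = solve 5 (λ m f₁ g₁ f₂ g₂ →
        m :* f₂ :* g₁ :+ f₁ :* g₂ := f₁ :* g₂ :+ m :* (f₂ :* g₁))
      ≈-refl m f₁ g₁ f₂ g₂

module ModPrime (p : ℕ) .{{_ : NonZero p}} (p-prime : Prime p) where

  -- Arithmetic in 𝔽ₚ and 𝔽ₚ[[x]]

  1<p : 1 < p
  1<p = nonTrivial⇒n>1 p {{prime⇒nonTrivial p-prime}}

  infix 4 _≃_ _≄0 _≈_

  record _≃_ (a b : ℕ) : Set where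
    constructor mod≡
    field %-≡ : a % p ≡ b % p
  open _≃_ public

  _≄0 : ℕ → Set
  a ≄0 = ¬ a ≃ 0

  ≃-reflexive : ∀ {a b} → a ≡ b → a ≃ b
  ≃-reflexive refl = mod≡ refl

  ≃-refl : ∀ {a} → a ≃ a
  ≃-refl = mod≡ refl

  ≃-sym : ∀ {a b} → a ≃ b → b ≃ a
  ≃-sym (mod≡ q) = mod≡ (sym q)

  ≃-trans : ∀ {a b c} → a ≃ b → b ≃ c → a ≃ c
  ≃-trans (mod≡ q) (mod≡ r) = mod≡ (trans q r)

  ≃-setoid : Setoid 0ℓ 0ℓ
  ≃-setoid = record
    { _≈_ = _≃_
    ; isEquivalence = record { refl = ≃-refl ; sym = ≃-sym ; trans = ≃-trans }
    }

  module ≃-Reasoning = SetoidReasoning ≃-setoid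

  +-cong-≃ : ∀ {a b c d} → a ≃ b → c ≃ d → a + c ≃ b + d
  +-cong-≃ {a} {b} {c} {d} (mod≡ q) (mod≡ r) = mod≡ (begin
    (a + c) % p          ≡⟨ %-distribˡ-+ a c p ⟩
    (a % p + c % p) % p  ≡⟨ cong₂ (λ x y → (x + y) % p) q r ⟩
    (b % p + d % p) % p  ≡⟨ %-distribˡ-+ b d p ⟨
    (b + d) % p          ∎)
    where open ≡-Reasoning

  *-cong-≃ : ∀ {a b c d} → a ≃ b → c ≃ d → a * c ≃ b * d
  *-cong-≃ {a} {b} {c} {d} (mod≡ q) (mod≡ r) = mod≡ (begin
    (a * c) % p              ≡⟨ %-distribˡ-* a c p ⟩
    ((a % p) * (c % p)) % p  ≡⟨ cong₂ (λ x y → (x * y) % p) q r ⟩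
    ((b % p) * (d % p)) % p  ≡⟨ %-distribˡ-* b d p ⟨
    (b * d) % p              ∎)
    where open ≡-Reasoning

  ∣⇒≃0 : ∀ {a} → p ∣ a → a ≃ 0
  ∣⇒≃0 {a} p∣a = mod≡ (trans (n∣m⇒m%n≡0 a p p∣a) (sym (n∣m⇒m%n≡0 0 p (p ∣0))))

  ≃0⇒∣ : ∀ {a} → a ≃ 0 → p ∣ a
  ≃0⇒∣ {a} (mod≡ q) = m%n≡0⇒n∣m a p (trans q (n∣m⇒m%n≡0 0 p (p ∣0)))

  ≃0? : ∀ a → Dec (a ≃ 0)
  ≃0? a with p ∣? a
  ... | yes p∣a = yes (∣⇒≃0 p∣a)
  ... | no  p∤a = no (p∤a ∘ ≃0⇒∣)

  *-zeroʳ-≃ : ∀ a {b} → b ≃ 0 → a * b ≃ 0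
  *-zeroʳ-≃ a b≃0 = ≃-trans (*-cong-≃ (≃-refl {a}) b≃0) (≃-reflexive (*-zeroʳ a))

  *-zeroˡ-≃ : ∀ {a} b → a ≃ 0 → a * b ≃ 0
  *-zeroˡ-≃ b a≃0 = *-cong-≃ a≃0 (≃-refl {b})

  +-zero-≃ : ∀ {a b} → a ≃ 0 → b ≃ 0 → a + b ≃ 0
  +-zero-≃ = +-cong-≃

  *-≃0 : ∀ {a b} → a ≄0 → a * b ≃ 0 → b ≃ 0
  *-≃0 {a} {b} a≄0 ab≃0 with euclidsLemma a b p-prime (≃0⇒∣ ab≃0)
  ... | inj₁ p∣a = ⊥-elim (a≄0 (∣⇒≃0 p∣a))
  ... | inj₂ p∣b = ∣⇒≃0 p∣b

  1≄0 : 1 ≄0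
  1≄0 (mod≡ q) with trans (sym (m<n⇒m%n≡m 1<p)) (trans q (n∣m⇒m%n≡0 0 p (p ∣0)))
  ... | ()

  -1ₚ : ℕ
  -1ₚ = p ∸ 1

  1-1≃0 : 1 + -1ₚ ≃ 0
  1-1≃0 = ∣⇒≃0 (subst (p ∣_) (sym (m+[n∸m]≡n (<⇒≤ 1<p))) ∣-refl)

  a-a≃0 : ∀ a → a + -1ₚ * a ≃ 0
  a-a≃0 a = *-zeroˡ-≃ a 1-1≃0

  +-cancelˡ-≃ : ∀ a {b c} → a + b ≃ a + c → b ≃ c
  +-cancelˡ-≃ a {b} {c} a+b≃a+c = begin
    b                     ≈⟨ +-cong-≃ (a-a≃0 a) (≃-refl {b}) ⟨
    a + -1ₚ * a + b       ≡⟨ swap a (-1ₚ * a) b ⟩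
    -1ₚ * a + (a + b)     ≈⟨ +-cong-≃ (≃-refl { -1ₚ * a}) a+b≃a+c ⟩
    -1ₚ * a + (a + c)     ≡⟨ swap a (-1ₚ * a) c ⟨
    a + -1ₚ * a + c       ≈⟨ +-cong-≃ (a-a≃0 a) (≃-refl {c}) ⟩
    c                     ∎
    where
    open ≃-Reasoning
    swap : ∀ x y z → x + y + z ≡ y + (x + z)
    swap = solve-∀

  +-≃0ˡ : ∀ {a b} → a ≃ 0 → a + b ≃ 0 → b ≃ 0
  +-≃0ˡ {a} {b} a≃0 a+b≃0 =
    ≃-trans (+-cong-≃ (≃-sym a≃0) (≃-refl {b})) a+b≃0

  +-≃0ʳ : ∀ {a b} → b ≃ 0 → a + b ≃ 0 → a ≃ 0
  +-≃0ʳ {a} {b} b≃0 a+b≃0 = +-≃0ˡ b≃0 (≃-trans (≃-reflexive (+-comm b a)) a+b≃0)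

  *-cancelʳ-≃ : ∀ c {a b} → c ≄0 → a * c ≃ b * c → a ≃ b
  *-cancelʳ-≃ c {a} {b} c≄0 ac≃bc = +-cancelˡ-≃ (-1ₚ * b) (begin
    -1ₚ * b + a  ≈⟨ *-≃0 c≄0 (begin
      c * (-1ₚ * b + a)      ≡⟨ expand c -1ₚ b a ⟩
      -1ₚ * (b * c) + a * c  ≈⟨ +-cong-≃ (≃-refl { -1ₚ * (b * c)}) ac≃bc ⟩
      -1ₚ * (b * c) + b * c  ≡⟨ +-comm (-1ₚ * (b * c)) (b * c) ⟩
      b * c + -1ₚ * (b * c)  ≈⟨ a-a≃0 (b * c) ⟩
      0                      ∎) ⟩
    0            ≈⟨ a-a≃0 b ⟨
    b + -1ₚ * b  ≡⟨ +-comm b _ ⟩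
    -1ₚ * b + b  ∎)
    where
    open ≃-Reasoning
    expand : ∀ c m b a → c * (m * b + a) ≡ m * (b * c) + a * c
    expand = solve-∀

  record _≈_ (f g : Form) : Set where
    constructor coeffs
    field at : ∀ i → f i ≃ g i
  open _≈_ public

  ≗⇒≈ : ∀ {f g} → f ≗ g → f ≈ g
  ≗⇒≈ f≗g = coeffs (λ i → ≃-reflexive (f≗g i))

  sumTo-cong-≃ : ∀ n {f g : ℕ → ℕ} → (∀ i → i ≤ n → f i ≃ g i) → sumTo n f ≃ sumTo n g
  sumTo-cong-≃ zero    f≃g = f≃g 0 z≤n
  sumTo-cong-≃ (suc n) f≃g =
    +-cong-≃ (sumTo-cong-≃ n (λ i i≤n → f≃g i (m≤n⇒m≤1+n i≤n))) (f≃g (suc n) ≤-refl)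

  sumTo-zero-≃ : ∀ n {f : ℕ → ℕ} → (∀ i → i ≤ n → f i ≃ 0) → sumTo n f ≃ 0
  sumTo-zero-≃ n f≃0 =
    ≃-trans (sumTo-cong-≃ n f≃0) (≃-reflexive (sumTo-* n 0 (λ _ → 0)))

  ⊛-cong-≈ : ∀ {f f′ g g′} → f ≈ f′ → g ≈ g′ → f ⊛ g ≈ f′ ⊛ g′
  ⊛-cong-≈ f≈ g≈ = coeffs (λ n → sumTo-cong-≃ n (λ i _ → *-cong-≃ (at f≈ i) (at g≈ (n ∸ i))))

  +-cong-≈ : ∀ {f f′ g g′} → f ≈ f′ → g ≈ g′ → addF f g ≈ addF f′ g′
  +-cong-≈ f≈ g≈ = coeffs (λ i → +-cong-≃ (at f≈ i) (at g≈ i))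

  ⊛-identityˡ : ∀ f → const 1 ⊛ f ≗ f
  ⊛-identityˡ f n = trans (⊛-const 1 f n) (*-identityˡ (f n))

  seriesSemiring : CommutativeSemiring 0ℓ 0ℓ
  seriesSemiring = record
    { Carrier = Form
    ; _≈_ = _≈_
    ; _+_ = addF
    ; _*_ = _⊛_
    ; 0# = zeroF
    ; 1# = const 1
    ; isCommutativeSemiring = record
      { isSemiring = record
        { isSemiringWithoutAnnihilatingZero = record
          { +-isCommutativeMonoid = record
            { isMonoid = record
              { isSemigroup = record
                { isMagma = record
                  { isEquivalence = record
                    { refl = ≗⇒≈ (λ _ → refl)
                    ; sym = λ e → coeffs (λ i → ≃-sym (at e i))
                    ; trans = λ e e′ → coeffs (λ i → ≃-trans (at e i) (at e′ i))
                    }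
                  ; ∙-cong = +-cong-≈
                  }
                ; assoc = λ f g h → ≗⇒≈ (λ i → +-assoc (f i) (g i) (h i))
                }
              ; identity = (λ f → ≗⇒≈ (λ _ → refl)) , (λ f → ≗⇒≈ (λ i → +-identityʳ (f i)))
              }
            ; comm = λ f g → ≗⇒≈ (λ i → +-comm (f i) (g i))
            }
          ; *-cong = ⊛-cong-≈
          ; *-assoc = λ f g h → ≗⇒≈ (⊛-assoc f g h)
          ; *-identity = (λ f → ≗⇒≈ (⊛-identityˡ f))
                       , (λ f → ≗⇒≈ (λ n → trans (⊛-comm f (const 1) n) (⊛-identityˡ f n)))
          ; distrib = (λ f g h → ≗⇒≈ (λ n → trans (⊛-comm f (addF g h) n)
                        (trans (⊛-distribʳ f g h n) (cong₂ _+_ (⊛-comm g f n) (⊛-comm h f n)))))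
                    , (λ f g h → ≗⇒≈ (⊛-distribʳ f g h))
          }
        ; zero = (λ f → ≗⇒≈ (⊛-zeroˡ f))
               , (λ f → ≗⇒≈ (λ n → trans (⊛-comm f zeroF n) (⊛-zeroˡ f n)))
        }
      ; *-comm = λ f g → ≗⇒≈ (⊛-comm f g)
      }
    }
  module 𝕊 = CommutativeSemiring seriesSemiring
  module ≈-Reasoning = SetoidReasoning 𝕊.setoid

  -𝟙 : Form
  -𝟙 = const -1ₚ

  1-1≈0 : addF (const 1) -𝟙 ≈ zeroF
  1-1≈0 = coeffs λ where
    zero    → 1-1≃0
    (suc _) → ≃-refl

  infixl 6 _⊖_
  _⊖_ : Form → Form → Form
  f ⊖ g = addF f (-𝟙 ⊛ g)

  open RingIdentities seriesSemiring

  -- Degree, order of vanishing and derivations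

  -- Deg k d f says deg f + k ≤ d, and f = 0 in case d < k.
  Deg : ℕ → ℕ → Form → Set
  Deg k d f = ∀ i → d < i + k → f i ≃ 0

  Low : ℕ → Form → Set
  Low a f = ∀ i → i < a → f i ≃ 0

  Deg-resp-≈ : ∀ {k d f g} → f ≈ g → Deg k d f → Deg k d g
  Deg-resp-≈ f≈g deg-f i d<i+k = ≃-trans (≃-sym (at f≈g i)) (deg-f i d<i+k)

  Low-resp-≈ : ∀ {a f g} → f ≈ g → Low a f → Low a g
  Low-resp-≈ f≈g low-f i i<a = ≃-trans (≃-sym (at f≈g i)) (low-f i i<a)

  Deg-+ : ∀ {k d f g} → Deg k d f → Deg k d g → Deg k d (addF f g)
  Deg-+ deg-f deg-g i d<i+k = +-zero-≃ (deg-f i d<i+k) (deg-g i d<i+k)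

  Low-+ : ∀ {a f g} → Low a f → Low a g → Low a (addF f g)
  Low-+ low-f low-g i i<a = +-zero-≃ (low-f i i<a) (low-g i i<a)

  Deg-scale : ∀ {k d f} a → Deg k d f → Deg k d (λ i → a * f i)
  Deg-scale a deg-f i d<i+k = *-zeroʳ-≃ a (deg-f i d<i+k)

  -- `Deg k d` bounds the degree by the integer d - k; the hypothesis compares two such bounds
  -- without subtraction.
  Deg-weaken : ∀ {k k′ d d′ f} → k′ + d ≤ k + d′ → Deg k d f → Deg k′ d′ f
  Deg-weaken {k} {k′} {d} {d′} le deg-f i d′<i+k′ = deg-f i (+-cancelˡ-< k′ d (i + k) (begin-strict
    k′ + d         ≤⟨ le ⟩
    k + d′         <⟨ +-monoʳ-< k d′<i+k′ ⟩
    k + (i + k′)   ≡⟨ perm k i k′ ⟩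
    k′ + (i + k)   ∎))
    where
    open ≤-Reasoning
    perm : ∀ a b c → a + (b + c) ≡ c + (b + a)
    perm = solve-∀

  Deg∧Low⇒0 : ∀ {k d a f} → d < a + k → Deg k d f → Low a f → f ≈ zeroF
  Deg∧Low⇒0 {k} {d} {a} d<a+k deg-f low-f = coeffs λ i → [ low-f i , (λ a≤i →
    deg-f i (<-≤-trans d<a+k (+-monoˡ-≤ k a≤i))) ]′ (<-≤-connex i a)

  ⊛-vanish : ∀ f g n → (∀ i → i ≤ n → f i ≃ 0 ⊎ g (n ∸ i) ≃ 0) → (f ⊛ g) n ≃ 0
  ⊛-vanish f g n vanish = sumTo-zero-≃ n λ i i≤n →
    [ *-zeroˡ-≃ (g (n ∸ i)) , *-zeroʳ-≃ (f i) ]′ (vanish i i≤n)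

  sumTo-single : ∀ n j {h} → j ≤ n → (∀ i → i ≤ n → i ≢ j → h i ≃ 0) → sumTo n h ≃ h j
  sumTo-single zero    .zero z≤n others = ≃-refl
  sumTo-single (suc n) j {h} j≤1+n others with j ≟ suc n
  ... | yes refl = +-cong-≃ {d = h j}
    (sumTo-zero-≃ n λ i i≤n → others i (m≤n⇒m≤1+n i≤n) (<⇒≢ (s≤s i≤n))) ≃-refl
  ... | no j≢1+n = ≃-trans
    (+-cong-≃ (sumTo-single n j {h} (≤-pred (≤∧≢⇒< j≤1+n j≢1+n))
                (λ i i≤n → others i (m≤n⇒m≤1+n i≤n)))
              (others (suc n) ≤-refl (j≢1+n ∘ sym)))
    (≃-reflexive (+-identityʳ (h j)))

  ⊛-single : ∀ f g n j → j ≤ n → (∀ i → i ≤ n → i ≢ j → f i ≃ 0 ⊎ g (n ∸ i) ≃ 0) →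
    (f ⊛ g) n ≃ f j * g (n ∸ j)
  ⊛-single f g n j j≤n others = sumTo-single n j {λ i → f i * g (n ∸ i)} j≤n λ i i≤n i≢j →
    [ *-zeroˡ-≃ (g (n ∸ i)) , *-zeroʳ-≃ (f i) ]′ (others i i≤n i≢j)

  Deg-⊛ : ∀ {k k′ d d′} f g → Deg k d f → Deg k′ d′ g → Deg (k + k′) (d + d′) (f ⊛ g)
  Deg-⊛ {k} {k′} {d} {d′} f g deg-f deg-g n big = ⊛-vanish f g n λ i i≤n → factor i i≤n
    where
    open ≤-Reasoning
    perm : ∀ a b c e → (a + b) + (c + e) ≡ (a + c) + (b + e)
    perm = solve-∀
    factor : ∀ i → i ≤ n → f i ≃ 0 ⊎ g (n ∸ i) ≃ 0
    factor i i≤n with <-≤-connex d (i + k) | <-≤-connex d′ (n ∸ i + k′)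
    ... | inj₁ d<i+k | _            = inj₁ (deg-f i d<i+k)
    ... | inj₂ _     | inj₁ d′<n-i+k′ = inj₂ (deg-g (n ∸ i) d′<n-i+k′)
    ... | inj₂ i+k≤d | inj₂ n-i+k′≤d′ = ⊥-elim (<⇒≱ big (begin
      n + (k + k′)               ≡⟨ cong (_+ (k + k′)) (m+[n∸m]≡n i≤n) ⟨
      (i + (n ∸ i)) + (k + k′)   ≡⟨ perm i (n ∸ i) k k′ ⟩
      (i + k) + (n ∸ i + k′)     ≤⟨ +-mono-≤ i+k≤d n-i+k′≤d′ ⟩
      d + d′                     ∎))

  Low-⊛ : ∀ {a b} f g → Low a f → Low b g → Low (a + b) (f ⊛ g)
  Low-⊛ {a} {b} f g low-f low-g n n<a+b = ⊛-vanish f g n factor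
    where
    factor : ∀ i → i ≤ n → f i ≃ 0 ⊎ g (n ∸ i) ≃ 0
    factor i i≤n with <-≤-connex i a
    ... | inj₁ i<a = inj₁ (low-f i i<a)
    ... | inj₂ a≤i = inj₂ (low-g (n ∸ i)
      (<-≤-trans (∸-monoˡ-< n<a+b i≤n) (m≤n+o⇒m∸n≤o (a + b) i (+-monoˡ-≤ b a≤i))))

  ⊛-lowest : ∀ {a b} f g → Low a f → Low b g → (f ⊛ g) (a + b) ≃ f a * g b
  ⊛-lowest {a} {b} f g low-f low-g = ≃-trans
    (⊛-single f g (a + b) a (m≤m+n a b) factor)
    (≃-reflexive (cong (λ k → f a * g k) (m+n∸m≡n a b)))
    where
    factor : ∀ i → i ≤ a + b → i ≢ a → f i ≃ 0 ⊎ g (a + b ∸ i) ≃ 0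
    factor i i≤a+b i≢a with <-cmp i a
    ... | tri< i<a _ _ = inj₁ (low-f i i<a)
    ... | tri≈ _ i≡a _ = ⊥-elim (i≢a i≡a)
    ... | tri> _ _ a<i = inj₂ (low-g _ (subst (a + b ∸ i <_) (m+n∸m≡n a b)
                                 (∸-monoʳ-< a<i i≤a+b)))

  Low-⊛ˡ : ∀ {a} f g → Low a f → Low a (f ⊛ g)
  Low-⊛ˡ {a} f g low-f i i<a = Low-⊛ {b = 0} f g low-f (λ _ ()) i
    (subst (i <_) (sym (+-identityʳ a)) i<a)

  Low-⊛ʳ : ∀ {a} f g → Low a g → Low a (f ⊛ g)
  Low-⊛ʳ f g low-g = Low-⊛ {a = 0} f g (λ _ ()) low-g

  -- Induction on b: the lowest possible coefficient of a product is the product of the two lowest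
  -- ones, and 𝔽ₚ has no zero divisors.
  Low-cancel : ∀ {a b} f g → Low a g → g a ≄0 → Low (b + a) (f ⊛ g) → Low b f
  Low-cancel {b = zero}  f g low-g ga≄0 low-fg _ ()
  Low-cancel {a} {suc b} f g low-g ga≄0 low-fg i i<1+b with m<1+n⇒m<n∨m≡n i<1+b
  ... | inj₁ i<b  = low-f i i<b
    where
    low-f : Low b f
    low-f = Low-cancel f g low-g ga≄0 (λ j j<b+a → low-fg j (m<n⇒m<1+n j<b+a))
  ... | inj₂ refl = *-≃0 ga≄0 (≃-trans (≃-reflexive (*-comm (g a) (f i)))
      (≃-trans (≃-sym (⊛-lowest f g low-f low-g)) (low-fg (i + a) (n<1+n (i + a)))))
    where
    low-f : Low i f
    low-f = Low-cancel f g low-g ga≄0 (λ j j<i+a → low-fg j (m<n⇒m<1+n j<i+a))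

  [1+x]-cong : ∀ {f g} → f ≈ g → [1+x] f ≈ [1+x] g
  [1+x]-cong f≈g = coeffs λ where
    zero    → at f≈g 0
    (suc n) → +-cong-≃ (at f≈g n) (at f≈g (suc n))

  [1+x]^-cong : ∀ c {f g} → f ≈ g → [1+x]^ c · f ≈ [1+x]^ c · g
  [1+x]^-cong zero    f≈g = f≈g
  [1+x]^-cong (suc c) f≈g = [1+x]-cong ([1+x]^-cong c f≈g)

  [1+x]^-zero : ∀ c → [1+x]^ c · zeroF ≈ zeroF
  [1+x]^-zero zero    = 𝕊.refl
  [1+x]^-zero (suc c) = 𝕊.trans ([1+x]-cong ([1+x]^-zero c))
    (≗⇒≈ λ where zero → refl ; (suc _) → refl)

  [1+x]^-+ : ∀ c f g → [1+x]^ c · (addF f g) ≈ addF ([1+x]^ c · f) ([1+x]^ c · g)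
  [1+x]^-+ zero    f g = 𝕊.refl
  [1+x]^-+ (suc c) f g = 𝕊.trans ([1+x]-cong ([1+x]^-+ c f g)) (≗⇒≈ λ where
      zero    → refl
      (suc n) → interchange (([1+x]^ c · f) n) _ _ _)
    where
    interchange : ∀ a b c d → (a + b) + (c + d) ≡ (a + c) + (b + d)
    interchange = solve-∀

  [1+x]^-scale : ∀ c a f → [1+x]^ c · (λ i → a * f i) ≈ (λ i → a * ([1+x]^ c · f) i)
  [1+x]^-scale zero    a f = 𝕊.refl
  [1+x]^-scale (suc c) a f = 𝕊.trans ([1+x]-cong ([1+x]^-scale c a f)) (≗⇒≈ λ where
      zero    → refl
      (suc n) → sym (*-distribˡ-+ a (([1+x]^ c · f) n) _))

  [1+x]^-x· : ∀ c f → [1+x]^ c · (x· f) ≈ x· ([1+x]^ c · f)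
  [1+x]^-x· zero    f = 𝕊.refl
  [1+x]^-x· (suc c) f = 𝕊.trans ([1+x]-cong ([1+x]^-x· c f)) (≗⇒≈ λ where
      zero          → refl
      (suc zero)    → refl
      (suc (suc n)) → refl)

  -- As a power series 1 + x is a unit with constant term 1, so multiplying by it affects neither
  -- the order at 0 nor the coefficient there.
  Low-[1+x]⁻ : ∀ {a} f → Low a ([1+x] f) → Low a f
  Low-[1+x]⁻ f low zero    i<a = low 0 i<a
  Low-[1+x]⁻ f low (suc i) i<a =
    +-≃0ˡ (Low-[1+x]⁻ f low i (<⇒≤ i<a)) (low (suc i) i<a)

  Low-[1+x]^⁻ : ∀ c {a} f → Low a ([1+x]^ c · f) → Low a f
  Low-[1+x]^⁻ zero    f low = low
  Low-[1+x]^⁻ (suc c) f low = Low-[1+x]^⁻ c f (Low-[1+x]⁻ ([1+x]^ c · f) low)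

  [1+x]^-≈0 : ∀ c f → [1+x]^ c · f ≈ zeroF → f ≈ zeroF
  [1+x]^-≈0 c f eq = coeffs λ i → Low-[1+x]^⁻ c {suc i} f (λ j _ → at eq j) i ≤-refl

  [1+x]-injective : ∀ {f g} → [1+x] f ≈ [1+x] g → f ≈ g
  [1+x]-injective {f} {g} eq = coeffs go
    where
    go : ∀ i → f i ≃ g i
    go zero    = at eq 0
    go (suc i) = +-cancelˡ-≃ (f i) (≃-trans (at eq (suc i))
      (+-cong-≃ (≃-sym (go i)) (≃-refl {g (suc i)})))

  Low-[1+x]^ : ∀ c {a} f → Low a f → Low a ([1+x]^ c · f)
  Low-[1+x]^ zero    f low = low
  Low-[1+x]^ (suc c) f low zero    i<a = Low-[1+x]^ c f low 0 i<a
  Low-[1+x]^ (suc c) f low (suc i) i<a =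
    +-zero-≃ (Low-[1+x]^ c f low i (<⇒≤ i<a)) (Low-[1+x]^ c f low (suc i) i<a)

  [1+x]^-lowest : ∀ c a f → Low a f → ([1+x]^ c · f) a ≃ f a
  [1+x]^-lowest zero    a       f low = ≃-refl
  [1+x]^-lowest (suc c) zero    f low = [1+x]^-lowest c 0 f low
  [1+x]^-lowest (suc c) (suc a) f low =
    +-cong-≃ (Low-[1+x]^ c f low a ≤-refl) ([1+x]^-lowest c (suc a) f low)

  Deg-[1+x] : ∀ {k d} f → Deg (suc k) d f → Deg k d ([1+x] f)
  Deg-[1+x] {k} {d} f deg zero    d<k = deg 0 (m<n⇒m<1+n d<k)
  Deg-[1+x] {k} {d} f deg (suc i) d<1+i+k = +-zero-≃
    (deg i (subst (d <_) (sym (+-suc i k)) d<1+i+k))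
    (deg (suc i) (<-≤-trans d<1+i+k (+-monoʳ-≤ (suc i) (n≤1+n k))))

  Deg-[1+x]^ : ∀ c {k d} f → Deg (c + k) d f → Deg k d ([1+x]^ c · f)
  Deg-[1+x]^ zero    f deg = deg
  Deg-[1+x]^ (suc c) {k} {d} f deg = Deg-[1+x] ([1+x]^ c · f)
    (Deg-[1+x]^ c f (subst (λ z → Deg z d f) (sym (+-suc c k)) deg))

  -- A polynomial with (1 + x) f = 0 beyond some degree has eventually
  -- alternating coefficients, so downward induction from N applies.
  Deg-[1+x]⁻ : ∀ {k d N} f → Deg 0 N f → Deg k d ([1+x] f) → Deg (suc k) d f
  Deg-[1+x]⁻ {k} {d} {N} f poly deg i d<i+1+k = go (suc N) i (m≤n+m (suc N) i) d<i+1+k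
    where
    go : ∀ j i → N < i + j → d < i + suc k → f i ≃ 0
    go zero    i N<i+0 _ = poly i N<i+0
    go (suc j) i N<i+1+j d<i+1+k = +-≃0ʳ
      (go j (suc i) (subst (N <_) (+-suc i j) N<i+1+j) (m<n⇒m<1+n d<i+1+k))
      (deg (suc i) (subst (d <_) (+-suc i k) d<i+1+k))

  Deg-[1+x]^⁻ : ∀ c {k d N} f → Deg 0 N f → Deg k d ([1+x]^ c · f) → Deg (c + k) d f
  Deg-[1+x]^⁻ zero    f poly deg = deg
  Deg-[1+x]^⁻ (suc c) {k} {d} {N} f poly deg = subst (λ z → Deg z d f) (+-suc c k)
    (Deg-[1+x]^⁻ c f poly (Deg-[1+x]⁻ ([1+x]^ c · f) poly′ deg))
    where
    poly′ : Deg 0 (c + N) ([1+x]^ c · f)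
    poly′ = Deg-[1+x]^ c f (Deg-weaken (≤-reflexive (cong (_+ N) (+-identityʳ c))) poly)

  [1+x]^-leading : ∀ c n f → Deg 0 n f → ([1+x]^ c · f) (c + n) ≃ f n
  [1+x]^-leading zero    n f poly = ≃-refl
  [1+x]^-leading (suc c) n f poly = ≃-trans
    (+-cong-≃ ([1+x]^-leading c n f poly)
      (Deg-[1+x]^ c {0} {c + n} f (Deg-weaken (≤-reflexive (cong (_+ n) (+-identityʳ c))) poly)
        (suc (c + n)) (s≤s (m≤m+n (c + n) 0))))
    (≃-reflexive (+-identityʳ (f n)))

  -- Derivations, and the p-th power of 1 + x

  [1+x]∂-cong : ∀ {f g} → f ≈ g → [1+x]∂ f ≈ [1+x]∂ g
  [1+x]∂-cong f≈g = coeffs λ i →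
    +-cong-≃ (*-cong-≃ (≃-refl {i}) (at f≈g i)) (*-cong-≃ (≃-refl {suc i}) (at f≈g (suc i)))

  [1+x]∂-[1+x] : ∀ f → [1+x]∂ ([1+x] f) ≈ [1+x] (addF f ([1+x]∂ f))
  [1+x]∂-[1+x] f = ≗⇒≈ λ where
      zero    → at-zero (f 0) (f 1)
      (suc n) → at-suc n (f n) (f (suc n)) (f (suc (suc n)))
    where
    at-zero : ∀ a b → 0 * a + 1 * (a + b) ≡ a + (0 * a + 1 * b)
    at-zero = solve-∀
    at-suc : ∀ n a b c → suc n * (a + b) + suc (suc n) * (b + c)
      ≡ (a + (n * a + suc n * b)) + (b + (suc n * b + suc (suc n) * c))
    at-suc = solve-∀

  -- (1 + x)^c is an eigenvector of (1 + x)∂ with eigenvalue c, so no factor 1 + x is lost.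
  [1+x]∂-[1+x]^ : ∀ c f →
    [1+x]∂ ([1+x]^ c · f) ≈ [1+x]^ c · (addF (λ i → c * f i) ([1+x]∂ f))
  [1+x]∂-[1+x]^ zero    f = 𝕊.refl
  [1+x]∂-[1+x]^ (suc c) f = begin
    [1+x]∂ ([1+x] ([1+x]^ c · f))
      ≈⟨ [1+x]∂-[1+x] ([1+x]^ c · f) ⟩
    [1+x] (addF ([1+x]^ c · f) ([1+x]∂ ([1+x]^ c · f)))
      ≈⟨ [1+x]-cong (+-cong-≈ 𝕊.refl ([1+x]∂-[1+x]^ c f)) ⟩
    [1+x] (addF ([1+x]^ c · f) ([1+x]^ c · (addF (λ i → c * f i) ([1+x]∂ f))))
      ≈⟨ [1+x]-cong ([1+x]^-+ c f _) ⟨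
    [1+x] ([1+x]^ c · (addF f (addF (λ i → c * f i) ([1+x]∂ f))))
      ≈⟨ [1+x]^-cong (suc c) (≗⇒≈ λ i → sym (+-assoc (f i) (c * f i) _)) ⟩
    [1+x]^ suc c · (addF (λ i → suc c * f i) ([1+x]∂ f)) ∎
    where open ≈-Reasoning

  [1+x]∂≈[1+x][∂] : ∀ f → [1+x]∂ f ≈ [1+x] (∂ f)
  [1+x]∂≈[1+x][∂] f = ≗⇒≈ λ where zero → refl ; (suc _) → refl

  [1+x][x∂]≈x·[1+x]∂ : ∀ f → [1+x] (x∂ f) ≈ x· ([1+x]∂ f)
  [1+x][x∂]≈x·[1+x]∂ f = ≗⇒≈ λ where zero → refl ; (suc _) → refl

  -- Since (1 + x) · x∂ = x · (1 + x)∂, the previous formula applies after multiplication by 1 + x,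
  -- which is then cancelled. This costs one factor 1 + x.
  x∂-[1+x]^ : ∀ c f →
    x∂ ([1+x]^ suc c · f) ≈ [1+x]^ c · (x· (addF (λ i → suc c * f i) ([1+x]∂ f)))
  x∂-[1+x]^ c f = [1+x]-injective (begin
    [1+x] (x∂ ([1+x]^ suc c · f))
      ≈⟨ [1+x][x∂]≈x·[1+x]∂ _ ⟩
    x· ([1+x]∂ ([1+x]^ suc c · f))
      ≈⟨ coeffs (λ where zero → ≃-refl ; (suc n) → at ([1+x]∂-[1+x]^ (suc c) f) n) ⟩
    x· ([1+x]^ suc c · (addF (λ i → suc c * f i) ([1+x]∂ f)))
      ≈⟨ [1+x]^-x· (suc c) _ ⟨
    [1+x]^ suc c · (x· (addF (λ i → suc c * f i) ([1+x]∂ f))) ∎)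
    where open ≈-Reasoning

  -- Coefficient i of (1 + x)∂f is the sum of the coefficients i and i + 1 of x∂f. Hence both
  -- derivations have the same kernel, the series in x^p.
  x∂≈0⇒[1+x]∂≈0 : ∀ {f} → x∂ f ≈ zeroF → [1+x]∂ f ≈ zeroF
  x∂≈0⇒[1+x]∂≈0 eq = coeffs λ i → +-zero-≃ (at eq i) (at eq (suc i))

  [1+x]∂≈0⇒x∂≈0 : ∀ {f} → [1+x]∂ f ≈ zeroF → x∂ f ≈ zeroF
  [1+x]∂≈0⇒x∂≈0 {f} eq = coeffs go
    where
    go : ∀ i → i * f i ≃ 0
    go zero    = ≃-refl
    go (suc i) = +-≃0ˡ (go i) (at eq i)

  x∂≈0⇒∤ : ∀ {f} → x∂ f ≈ zeroF → ∀ i → ¬ p ∣ i → f i ≃ 0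
  x∂≈0⇒∤ eq i p∤i = *-≃0 (p∤i ∘ ≃0⇒∣) (at eq i)

  -- (1 + x)^p has zero derivative, so only its extreme coefficients survive.
  [1+x]^p≈1+x^p : [1+x]^ p · const 1 ≈ addF (const 1) (xPow p)
  [1+x]^p≈1+x^p = coeffs coefficient
    where
    1+x^p = [1+x]^ p · const 1
    deg-1 : Deg 0 0 (const 1)
    deg-1 (suc i) _ = ≃-refl
    deg-p : Deg 0 p 1+x^p
    deg-p = Deg-[1+x]^ p (const 1) λ where
      zero    p<p+0 → ⊥-elim (<-irrefl (sym (+-identityʳ p)) p<p+0)
      (suc _) _     → ≃-refl
    [1+x]∂-1 : [1+x]∂ (const 1) ≈ zeroF
    [1+x]∂-1 = ≗⇒≈ λ i → cong₂ _+_ (x∂-1 i) (*-zeroʳ (suc i))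
      where
      x∂-1 : ∀ i → i * const 1 i ≡ 0
      x∂-1 zero    = refl
      x∂-1 (suc i) = *-zeroʳ (suc i)
    derivative : x∂ 1+x^p ≈ zeroF
    derivative = [1+x]∂≈0⇒x∂≈0 (𝕊.trans ([1+x]∂-[1+x]^ p (const 1))
      (𝕊.trans ([1+x]^-cong p {g = zeroF} (coeffs λ i →
        +-zero-≃ (*-zeroˡ-≃ (const 1 i) (∣⇒≃0 ∣-refl)) (at [1+x]∂-1 i)))
      ([1+x]^-zero p)))
    coefficient : ∀ i → 1+x^p i ≃ const 1 i + xPow p i
    coefficient zero = ≃-trans ([1+x]^-lowest p 0 (const 1) (λ _ ()))
      (≃-reflexive (cong (1 +_) (sym (xPow-off p 0 (<⇒≢ (<⇒≤ 1<p))))))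
    coefficient (suc i) with <-cmp (suc i) p
    ... | tri< 1+i<p 1+i≢p _ = ≃-trans
      (x∂≈0⇒∤ derivative (suc i) (λ p∣1+i → <⇒≱ 1+i<p (∣⇒≤ p∣1+i)))
      (≃-reflexive (sym (xPow-off p (suc i) 1+i≢p)))
    ... | tri> _ 1+i≢p p<1+i = ≃-trans
      (deg-p (suc i) (≤-trans p<1+i (m≤m+n (suc i) 0)))
      (≃-reflexive (sym (xPow-off p (suc i) 1+i≢p)))
    ... | tri≈ _ refl _ = ≃-trans
      (subst (λ k → 1+x^p k ≃ 1) (+-identityʳ (suc i)) ([1+x]^-leading p 0 (const 1) deg-1))
      (≃-reflexive (sym (xPow-diag (suc i))))

  -- The Frobenius and the modules D(A, μ)

  ⊛-congˡ : ∀ {f f′} g → f ≈ f′ → f ⊛ g ≈ f′ ⊛ g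
  ⊛-congˡ g f≈ = ⊛-cong-≈ {g = g} f≈ 𝕊.refl

  ⊛-congʳ : ∀ f {g g′} → g ≈ g′ → f ⊛ g ≈ f ⊛ g′
  ⊛-congʳ f g≈ = ⊛-cong-≈ {f = f} 𝕊.refl g≈

  xPow-⊛ : ∀ a g {n} → a ≤ n → (xPow a ⊛ g) n ≃ g (n ∸ a)
  xPow-⊛ a g {n} a≤n = ≃-trans
    (⊛-single (xPow a) g n a a≤n (λ i _ i≢a → inj₁ (≃-reflexive (xPow-off a i i≢a))))
    (≃-reflexive (trans (cong (_* g (n ∸ a)) (xPow-diag a)) (*-identityˡ _)))

  Low-xPow : ∀ a → Low a (xPow a)
  Low-xPow a i i<a = ≃-reflexive (xPow-off a i (<⇒≢ i<a))

  Deg-xPow : ∀ a k → Deg k (a + k) (xPow a)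
  Deg-xPow a k i a+k<i+k =
    ≃-reflexive (xPow-off a i (λ i≡a → <⇒≢ (+-cancelʳ-< k a i a+k<i+k) (sym i≡a)))

  inflate-at : Form → ∀ {i} → Dec (p ∣ i) → ℕ
  inflate-at f (yes (divides q _)) = f q
  inflate-at f (no _)              = 0

  -- f(x) ↦ f(x^p), the Frobenius on polynomials over 𝔽_p.
  inflate : Form → Form
  inflate f i = inflate-at f (p ∣? i)

  inflate-* : ∀ f q → inflate f (q * p) ≡ f q
  inflate-* f q with p ∣? (q * p)
  ... | yes (divides q′ eq) = cong f (sym (*-cancelʳ-≡ q q′ p eq))
  ... | no  p∤qp            = ⊥-elim (p∤qp (n∣m*n q))

  inflate-∤ : ∀ f {i} → ¬ p ∣ i → inflate f i ≡ 0
  inflate-∤ f {i} p∤i with p ∣? i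
  ... | yes p∣i = ⊥-elim (p∤i p∣i)
  ... | no  _   = refl

  inflate-cong : ∀ {f g} → f ≈ g → inflate f ≈ inflate g
  inflate-cong {f} {g} f≈g = coeffs λ i → go (p ∣? i)
    where
    go : ∀ {i} (d : Dec (p ∣ i)) → inflate-at f d ≃ inflate-at g d
    go (yes (divides q _)) = at f≈g q
    go (no _)              = ≃-refl

  inflate-[1+x] : ∀ f → [1+x]^ p · inflate f ≈ inflate ([1+x] f)
  inflate-[1+x] f = coeffs coefficient
    where
    F = inflate f
    as-sum : [1+x]^ p · F ≈ addF F (xPow p ⊛ F)
    as-sum = begin
      [1+x]^ p · F                      ≈⟨ [1+x]^-cong p (𝕊.*-identityˡ F) ⟨
      [1+x]^ p · (const 1 ⊛ F)          ≈⟨ ≗⇒≈ ([1+x]^-⊛ p (const 1) F) ⟩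
      ([1+x]^ p · const 1) ⊛ F          ≈⟨ ⊛-congˡ F [1+x]^p≈1+x^p ⟩
      addF (const 1) (xPow p) ⊛ F       ≈⟨ 𝕊.distribʳ F (const 1) (xPow p) ⟩
      addF (const 1 ⊛ F) (xPow p ⊛ F)   ≈⟨ +-cong-≈ (𝕊.*-identityˡ F) 𝕊.refl ⟩
      addF F (xPow p ⊛ F)               ∎
      where open ≈-Reasoning
    at-multiple : ∀ q → F (q * p) + (xPow p ⊛ F) (q * p) ≃ inflate ([1+x] f) (q * p)
    at-multiple zero = ≃-trans
      (+-cong-≃ (≃-reflexive (inflate-* f 0))
        (Low-⊛ˡ (xPow p) F (Low-xPow p) 0 (<⇒≤ 1<p)))
      (≃-reflexive (trans (+-identityʳ (f 0)) (sym (inflate-* ([1+x] f) 0))))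
    at-multiple (suc q) = begin
      F (suc q * p) + (xPow p ⊛ F) (p + q * p)
        ≈⟨ +-cong-≃ (≃-reflexive (inflate-* f (suc q))) (xPow-⊛ p F (m≤m+n p (q * p))) ⟩
      f (suc q) + F (p + q * p ∸ p)
        ≡⟨ cong (λ k → f (suc q) + F k) (m+n∸m≡n p (q * p)) ⟩
      f (suc q) + F (q * p)
        ≡⟨ cong (f (suc q) +_) (inflate-* f q) ⟩
      f (suc q) + f q
        ≡⟨ +-comm (f (suc q)) (f q) ⟩
      f q + f (suc q)
        ≡⟨ inflate-* ([1+x] f) (suc q) ⟨
      inflate ([1+x] f) (suc q * p) ∎
      where open ≃-Reasoning
    coefficient : ∀ n → ([1+x]^ p · F) n ≃ inflate ([1+x] f) n
    coefficient n with p ∣? n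
    ... | yes (divides q refl) = ≃-trans (at as-sum n)
        (≃-trans (at-multiple q) (≃-reflexive (inflate-* ([1+x] f) q)))
    ... | no p∤n = ≃-trans (at as-sum n)
      (+-zero-≃ (≃-reflexive (inflate-∤ f p∤n)) (⊛-vanish (xPow p) F n factor))
      where
      factor : ∀ i → i ≤ n → xPow p i ≃ 0 ⊎ F (n ∸ i) ≃ 0
      factor i i≤n with i ≟ p
      ... | no i≢p   = inj₁ (≃-reflexive (xPow-off p i i≢p))
      ... | yes refl = inj₂ (≃-reflexive (inflate-∤ f
        (λ p∣n-p → p∤n (∣m∸n∣n⇒∣m p i≤n p∣n-p ∣-refl))))

  inflate-[1+x]^ : ∀ c f → [1+x]^ (c * p) · inflate f ≈ inflate ([1+x]^ c · f)
  inflate-[1+x]^ zero    f = 𝕊.refl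
  inflate-[1+x]^ (suc c) f = 𝕊.trans
    (≗⇒≈ (λ i → cong (λ h → h i) ([1+x]^-+-exp p (c * p) (inflate f))))
    (𝕊.trans ([1+x]^-cong p (inflate-[1+x]^ c f)) (inflate-[1+x] ([1+x]^ c · f)))

  -- Once y = 1, divisibility of a form of degree d by y^b says that its degree
  -- in x is at most d − b.
  record Mem (μ : Λ) (d : ℕ) (θ : Der) : Set where
    field
      low   : Low (μ₁ μ) (proj₁ θ)
      deg-f : Deg 0 d (proj₁ θ)
      deg-g : Deg (μ₂ μ) d (proj₂ θ)
      C     : Form
      deg-C : Deg (μ₃ μ) d C
      sum   : addF (proj₁ θ) (proj₂ θ) ≈ [1+x]^ (μ₃ μ) · C

  NonZ : Der → Set
  NonZ (f , g) = ¬ (f ≈ zeroF × g ≈ zeroF)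

  Deg-drop : ∀ {k d} f → Deg k d f → Deg 0 d f
  Deg-drop {k} {d} f deg = Deg-weaken {k} {0} {d} {d} (m≤n+m d k) deg

  Deg-[1+x]^-drop : ∀ c {d} f → Deg c d f → Deg 0 d ([1+x]^ c · f)
  Deg-[1+x]^-drop c {d} f deg =
    Deg-[1+x]^ c f (subst (λ k → Deg k d f) (sym (+-identityʳ c)) deg)

  Deg-trunc : ∀ k e f → Deg k (e + k) (trunc e f)
  Deg-trunc k e f i e+k<i+k = ≃-reflexive (trunc-> e f (+-cancelʳ-< k e i e+k<i+k))

  Deg-trunc₀ : ∀ d f → Deg 0 d (trunc d f)
  Deg-trunc₀ d f = subst (λ d′ → Deg 0 d′ (trunc d f)) (+-identityʳ d) (Deg-trunc 0 d f)

  trunc-Deg : ∀ k {d e f} → d ≤ e + k → Deg k d f → trunc e f ≈ f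
  trunc-Deg k {d} {e} {f} d≤e+k deg = coeffs λ i → [ (λ i≤e → ≃-reflexive (trunc-≤ e f i≤e)) ,
    (λ e<i → ≃-trans (≃-reflexive (trunc-> e f e<i))
      (≃-sym (deg i (≤-<-trans d≤e+k (+-monoˡ-< k e<i))))) ]′ (≤-<-connex i e)

  trunc-xPow : ∀ a → trunc a (xPow a) ≈ xPow a
  trunc-xPow a = trunc-Deg 0 (≤-reflexive refl) (Deg-xPow a 0)

  trunc-xPlusYPow : ∀ c → trunc c (xPlusYPow c) ≈ [1+x]^ c · const 1
  trunc-xPlusYPow zero    = ≗⇒≈ λ where zero → refl ; (suc _) → refl
  trunc-xPlusYPow (suc c) = coeffs λ i → [ inside i , outside i ]′ (≤-<-connex i (suc c))
    where
    B = trunc c (xPlusYPow c)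
    x+y : trunc 1 xPlusY ≗ [1+x] (const 1)
    x+y zero          = refl
    x+y (suc zero)    = refl
    x+y (suc (suc _)) = refl
    deg : Deg 0 (suc c) ([1+x]^ suc c · const 1)
    deg = Deg-[1+x]^-drop (suc c) (const 1) λ where
      zero    1+c<1+c → ⊥-elim (<-irrefl refl 1+c<1+c)
      (suc _) _       → ≃-refl
    inside : ∀ i → i ≤ suc c → trunc (suc c) (xPlusYPow (suc c)) i ≃ ([1+x]^ suc c · const 1) i
    inside i i≤1+c = begin
      trunc (suc c) (xPlusYPow (suc c)) i  ≡⟨ trunc-≤ (suc c) (xPlusYPow (suc c)) i≤1+c ⟩
      (trunc 1 xPlusY ⊛ B) i               ≡⟨ ⊛-cong {g = B} x+y (λ _ → refl) i ⟩
      (([1+x] const 1) ⊛ B) i              ≡⟨ [1+x]-⊛ (const 1) B i ⟨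
      ([1+x] (const 1 ⊛ B)) i              ≈⟨ at ([1+x]-cong (𝕊.*-identityˡ B)) i ⟩
      ([1+x] B) i                          ≈⟨ at ([1+x]-cong (trunc-xPlusYPow c)) i ⟩
      ([1+x]^ suc c · const 1) i           ∎
      where open ≃-Reasoning
    outside : ∀ i → suc c < i → trunc (suc c) (xPlusYPow (suc c)) i ≃ ([1+x]^ suc c · const 1) i
    outside i 1+c<i = ≃-trans (≃-reflexive (trunc-> (suc c) (xPlusYPow (suc c)) 1+c<i))
      (≃-sym (deg i (subst (suc c <_) (sym (+-identityʳ i)) 1+c<i)))

  ⊛-xPlusYPow : ∀ c f → f ⊛ trunc c (xPlusYPow c) ≈ [1+x]^ c · f
  ⊛-xPlusYPow c f = begin
    f ⊛ trunc c (xPlusYPow c)     ≈⟨ 𝕊.*-comm f (trunc c (xPlusYPow c)) ⟩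
    trunc c (xPlusYPow c) ⊛ f     ≈⟨ ⊛-congˡ f (trunc-xPlusYPow c) ⟩
    ([1+x]^ c · const 1) ⊛ f      ≈⟨ ≗⇒≈ ([1+x]^-⊛ c (const 1) f) ⟨
    [1+x]^ c · (const 1 ⊛ f)      ≈⟨ [1+x]^-cong c (𝕊.*-identityˡ f) ⟩
    [1+x]^ c · f                  ∎
    where open ≈-Reasoning

  -- Translation of forms, membership and bases to y = 1

  EqF⇒≃ : ∀ {d f g} → EqF p d f g → ∀ i → i ≤ d → f i ≃ g i
  EqF⇒≃ eq i i≤d = mod≡ (eq i i≤d)

  ≃⇒EqF : ∀ {d f g} → (∀ i → i ≤ d → f i ≃ g i) → EqF p d f g
  ≃⇒EqF eq i i≤d = %-≡ (eq i i≤d)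

  ≈⇒EqF : ∀ {d f g} → f ≈ g → EqF p d f g
  ≈⇒EqF f≈g = ≃⇒EqF (λ i _ → at f≈g i)

  extend : ∀ {d f g} → Deg 0 d f → Deg 0 d g → (∀ i → i ≤ d → f i ≃ g i) → f ≈ g
  extend {d} deg-f deg-g eq = coeffs λ i → [ eq i , (λ d<i →
    let d<i+0 = subst (d <_) (sym (+-identityʳ i)) d<i in
    ≃-trans (deg-f i d<i+0) (≃-sym (deg-g i d<i+0))) ]′ (≤-<-connex i d)

  EqF⇒≈ : ∀ d {f g} → EqF p d f g → Deg 0 d g → trunc d f ≈ g
  EqF⇒≈ d {f} eq deg-g = extend (Deg-trunc₀ d f) deg-g
    (λ i i≤d → ≃-trans (≃-reflexive (trunc-≤ d f i≤d)) (EqF⇒≃ eq i i≤d))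

  Divides-xPow⇒Low : ∀ {a d f} → Divides p a (xPow a) d f → Low a (trunc d f)
  Divides-xPow⇒Low {a} {d} {f} (inj₁ (e , h , _ , eq)) i i<a with ≤-<-connex i d
  ... | inj₂ d<i = ≃-reflexive (trunc-> d f d<i)
  ... | inj₁ i≤d = ≃-trans (≃-reflexive (trunc-≤ d f i≤d)) (≃-trans (≃-sym (EqF⇒≃ eq i i≤d))
    (Low-⊛ʳ (trunc e h) (trunc a (xPow a))
      (Low-resp-≈ (𝕊.sym (trunc-xPow a)) (Low-xPow a)) i i<a))
  Divides-xPow⇒Low {d = d} {f} (inj₂ eq) i _ = at (EqF⇒≈ d {f} {zeroF} eq (λ _ _ → ≃-refl)) i

  Divides-yPow⇒Deg : ∀ {b d g} → Divides p b (yPow b) d g → Deg b d (trunc d g)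
  Divides-yPow⇒Deg {b} {g = g} (inj₁ (e , h , refl , eq)) = Deg-resp-≈
    (𝕊.sym (EqF⇒≈ (e + b) {g} {trunc e h}
      (λ i i≤ → trans (sym (eq i i≤)) (%-≡ (at yPow-unit i)))
      (Deg-drop (trunc e h) (Deg-trunc b e h))))
    (Deg-trunc b e h)
    where
    yPow-unit : trunc e h ⊛ trunc b (yPow b) ≈ trunc e h
    yPow-unit = 𝕊.trans (⊛-congʳ (trunc e h) (≗⇒≈ (trunc-yPow b))) (𝕊.*-identityʳ (trunc e h))
  Divides-yPow⇒Deg {d = d} {g} (inj₂ eq) i _ = at (EqF⇒≈ d {g} {zeroF} eq (λ _ _ → ≃-refl)) i

  Divides-xPlusYPow⇒ : ∀ {c d f} → Divides p c (xPlusYPow c) d f →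
    Σ[ C ∈ Form ] (Deg c d C × trunc d f ≈ [1+x]^ c · C)
  Divides-xPlusYPow⇒ {c} {f = f} (inj₁ (e , h , refl , eq)) =
    trunc e h , Deg-trunc c e h ,
    EqF⇒≈ (e + c) {f}
      (λ i i≤ → trans (sym (eq i i≤)) (%-≡ (at (⊛-xPlusYPow c (trunc e h)) i)))
      (Deg-[1+x]^-drop c (trunc e h) (Deg-trunc c e h))
  Divides-xPlusYPow⇒ {c} {d} {f} (inj₂ eq) =
    zeroF , (λ _ _ → ≃-refl) ,
    𝕊.trans (EqF⇒≈ d {f} {zeroF} eq (λ _ _ → ≃-refl)) (𝕊.sym ([1+x]^-zero c))

  trunc-addF : ∀ d f g → addF (trunc d f) (trunc d g) ≗ trunc d (addF f g)
  trunc-addF d f g i with i ≤ᵇ d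
  ... | true  = refl
  ... | false = refl

  -- `EqF` ignores coefficients beyond the degree while `_≈_` reads all of them; truncation makes
  -- the two agree.
  truncD : ℕ → Der → Der
  truncD d (f , g) = trunc d f , trunc d g

  InD⇒Mem : ∀ {μ d θ} → InD p μ d θ → Mem μ d (truncD d θ)
  InD⇒Mem {d = d} {f , g} (x∣f , y∣g , x+y∣f+g) =
    let C , deg-C , f+g≈ = Divides-xPlusYPow⇒ x+y∣f+g in record
    { low   = Divides-xPow⇒Low x∣f
    ; deg-f = Deg-trunc₀ d f
    ; deg-g = Divides-yPow⇒Deg y∣g
    ; C     = C
    ; deg-C = deg-C
    ; sum   = 𝕊.trans (≗⇒≈ (trunc-addF d f g)) f+g≈
    }

  Low⇒Divides-xPow : ∀ {a d f} → Low a f → Divides p a (xPow a) d f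
  Low⇒Divides-xPow {a} {d} {f} low with ≤-<-connex a d
  -- In degree d < a only the zero form is divisible by x^a, and there is no quotient degree: this
  -- is the second alternative of `Divides`.
  ... | inj₂ d<a = inj₂ (≃⇒EqF (λ i i≤d → low i (≤-<-trans i≤d d<a)))
  ... | inj₁ a≤d = inj₁ (d ∸ a , h , m∸n+n≡m a≤d , ≃⇒EqF product)
    where
    h : Form
    h i = f (i + a)
    product : ∀ i → i ≤ d → (trunc (d ∸ a) h ⊛ trunc a (xPow a)) i ≃ f i
    product i i≤d = ≃-trans
      (at (𝕊.trans (𝕊.*-comm (trunc (d ∸ a) h) (trunc a (xPow a)))
        (⊛-congˡ (trunc (d ∸ a) h) (trunc-xPow a))) i)
      (value (≤-<-connex a i))
      where
      value : a ≤ i ⊎ i < a → (xPow a ⊛ trunc (d ∸ a) h) i ≃ f i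
      value (inj₁ a≤i) = ≃-trans (xPow-⊛ a (trunc (d ∸ a) h) a≤i) (≃-reflexive
        (trans (trunc-≤ (d ∸ a) h (∸-monoˡ-≤ a i≤d)) (cong f (m∸n+n≡m a≤i))))
      value (inj₂ i<a) = ≃-trans (Low-⊛ˡ (xPow a) (trunc (d ∸ a) h) (Low-xPow a) i i<a)
        (≃-sym (low i i<a))

  Deg⇒Divides-yPow : ∀ {b d g} → Deg b d g → Divides p b (yPow b) d g
  Deg⇒Divides-yPow {b} {d} {g} deg with ≤-<-connex b d
  ... | inj₂ d<b = inj₂ (≃⇒EqF (λ i _ → deg i (<-≤-trans d<b (m≤n+m b i))))
  ... | inj₁ b≤d = inj₁ (d ∸ b , g , m∸n+n≡m b≤d , ≈⇒EqF (begin
    trunc (d ∸ b) g ⊛ trunc b (yPow b)  ≈⟨ ⊛-congʳ (trunc (d ∸ b) g) (≗⇒≈ (trunc-yPow b)) ⟩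
    trunc (d ∸ b) g ⊛ const 1           ≈⟨ 𝕊.*-identityʳ _ ⟩
    trunc (d ∸ b) g                     ≈⟨ trunc-Deg b (≤-reflexive (sym (m∸n+n≡m b≤d))) deg ⟩
    g                                   ∎))
    where open ≈-Reasoning

  ⇒Divides-xPlusYPow : ∀ {c d f} C → Deg c d C → f ≈ [1+x]^ c · C →
    Divides p c (xPlusYPow c) d f
  ⇒Divides-xPlusYPow {c} {d} {f} C deg f≈ with ≤-<-connex c d
  ... | inj₂ d<c = inj₂ (≈⇒EqF (𝕊.trans f≈ (𝕊.trans
    ([1+x]^-cong c {g = zeroF} (coeffs (λ i → deg i (<-≤-trans d<c (m≤n+m c i)))))
    ([1+x]^-zero c))))
  ... | inj₁ c≤d = inj₁ (d ∸ c , C , m∸n+n≡m c≤d , ≈⇒EqF (begin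
    trunc (d ∸ c) C ⊛ trunc c (xPlusYPow c)  ≈⟨ ⊛-xPlusYPow c _ ⟩
    [1+x]^ c · trunc (d ∸ c) C
      ≈⟨ [1+x]^-cong c (trunc-Deg c (≤-reflexive (sym (m∸n+n≡m c≤d))) deg) ⟩
    [1+x]^ c · C                             ≈⟨ f≈ ⟨
    f                                        ∎))
    where open ≈-Reasoning

  Mem⇒InD : ∀ {μ d θ} → Mem μ d θ → InD p μ d θ
  Mem⇒InD {μ} m =
    Low⇒Divides-xPow {μ₁ μ} low , Deg⇒Divides-yPow deg-g , ⇒Divides-xPlusYPow C deg-C sum
    where open Mem m

  -- `Exponents` at y = 1. A cofactor of degree d - dᵢ is one satisfying `Deg dᵢ d`, which also
  -- makes it zero when d < dᵢ.
  record Basis (μ : Λ) (d₁ d₂ : ℕ) : Set where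
    field
      f₁ g₁ f₂ g₂ : Form
      mem₁  : Mem μ d₁ (f₁ , g₁)
      mem₂  : Mem μ d₂ (f₂ , g₂)
      span  : ∀ {d f g} → Mem μ d (f , g) → Σ[ u ∈ Form ] Σ[ v ∈ Form ]
                (Deg d₁ d u × Deg d₂ d v
                 × f ≈ addF (u ⊛ f₁) (v ⊛ f₂) × g ≈ addF (u ⊛ g₁) (v ⊛ g₂))
      indep : ∀ {d u v} → Deg d₁ d u → Deg d₂ d v →
                addF (u ⊛ f₁) (v ⊛ f₂) ≈ zeroF → addF (u ⊛ g₁) (v ⊛ g₂) ≈ zeroF →
                u ≈ zeroF × v ≈ zeroF

  -- Absorbs the case distinction of `term`, so that both of its cases become one convolution.
  cofactor : ℕ → ℕ → Form → Form
  cofactor d dt a i with dt ≤ᵇ d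
  ... | true  = trunc (d ∸ dt) a i
  ... | false = 0

  term-⊛ : ∀ d dt a t → term d dt a t ≗ cofactor d dt a ⊛ trunc dt t
  term-⊛ d dt a t i with dt ≤ᵇ d
  ... | true  = refl
  ... | false = sym (⊛-zeroˡ (trunc dt t) i)

  Deg-cofactor : ∀ d dt a → Deg dt d (cofactor d dt a)
  Deg-cofactor d dt a i d<i+dt with dt ≤ᵇ d in eq
  ... | false = ≃-refl
  ... | true  = subst (λ d′ → Deg dt d′ (trunc (d ∸ dt) a))
    (m∸n+n≡m (≤ᵇ⇒≤ dt d (subst T (sym eq) _))) (Deg-trunc dt (d ∸ dt) a) i d<i+dt

  cofactor-Deg : ∀ {d dt a} → Deg dt d a → cofactor d dt a ≈ a
  cofactor-Deg {d} {dt} {a} deg = coeffs coefficient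
    where
    coefficient : ∀ i → cofactor d dt a i ≃ a i
    coefficient i with ≤-<-connex dt d
    ... | inj₁ dt≤d rewrite ≤ᵇ-true dt≤d =
      at (trunc-Deg dt (≤-reflexive (sym (m∸n+n≡m dt≤d))) deg) i
    ... | inj₂ d<dt rewrite ≤ᵇ-false d<dt = ≃-sym (deg i (<-≤-trans d<dt (m≤n+m dt i)))

  combo-Deg : ∀ {d d₁ d₂ u v f g} → Deg d₁ d u → Deg d₂ d v → Deg 0 d₁ f → Deg 0 d₂ g →
    Deg 0 d (addF (u ⊛ f) (v ⊛ g))
  combo-Deg {d} {d₁} {d₂} {u} {v} {f} {g} deg-u deg-v deg-f deg-g = Deg-+
    (Deg-weaken (≤-reflexive (shuffle d d₁)) (Deg-⊛ u f deg-u deg-f))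
    (Deg-weaken (≤-reflexive (shuffle d d₂)) (Deg-⊛ v g deg-v deg-g))
    where
    shuffle : ∀ d e → 0 + (d + e) ≡ e + 0 + d
    shuffle = solve-∀

  Exponents⇒Basis : ∀ {μ d₁ d₂} → Exponents p μ d₁ d₂ → Basis μ d₁ d₂
  Exponents⇒Basis {μ} {d₁} {d₂}
    (θ₁@(f₁ , g₁) , θ₂@(f₂ , g₂) , in₁ , in₂ , generate , independent) = record
    { mem₁  = mem₁
    ; mem₂  = mem₂
    ; span  = span
    ; indep = indep
    }
    where
    mem₁ : Mem μ d₁ (truncD d₁ θ₁)
    mem₁ = InD⇒Mem in₁
    mem₂ : Mem μ d₂ (truncD d₂ θ₂)
    mem₂ = InD⇒Mem in₂
    F : Form → Form → Form
    F u v = addF (u ⊛ trunc d₁ f₁) (v ⊛ trunc d₂ f₂)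
    G : Form → Form → Form
    G u v = addF (u ⊛ trunc d₁ g₁) (v ⊛ trunc d₂ g₂)
    span : ∀ {d f g} → Mem μ d (f , g) → Σ[ u ∈ Form ] Σ[ v ∈ Form ]
      (Deg d₁ d u × Deg d₂ d v × f ≈ F u v × g ≈ G u v)
    span {d} {f} {g} m with generate d (f , g) (Mem⇒InD m)
    ... | a , b , eq-f , eq-g =
      u , v , deg-u , deg-v ,
      extend (Mem.deg-f m) (combo-Deg deg-u deg-v (Deg-trunc₀ d₁ f₁) (Deg-trunc₀ d₂ f₂))
        (λ i i≤d → ≃-trans (≃-sym (EqF⇒≃ eq-f i i≤d))
          (≃-reflexive (cong₂ _+_ (term-⊛ d d₁ a f₁ i) (term-⊛ d d₂ b f₂ i)))) ,
      extend (Deg-drop g (Mem.deg-g m))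
        (combo-Deg deg-u deg-v (Deg-trunc₀ d₁ g₁) (Deg-trunc₀ d₂ g₂))
        (λ i i≤d → ≃-trans (≃-sym (EqF⇒≃ eq-g i i≤d))
          (≃-reflexive (cong₂ _+_ (term-⊛ d d₁ a g₁ i) (term-⊛ d d₂ b g₂ i))))
      where
      u v : Form
      u = cofactor d d₁ a
      v = cofactor d d₂ b
      deg-u = Deg-cofactor d d₁ a
      deg-v = Deg-cofactor d d₂ b
    indep : ∀ {d u v} → Deg d₁ d u → Deg d₂ d v → F u v ≈ zeroF → G u v ≈ zeroF →
      u ≈ zeroF × v ≈ zeroF
    indep {d} {u} {v} deg-u deg-v F≈0 G≈0 =
      vanish d₁ u deg-u (proj₁ result) , vanish d₂ v deg-v (proj₂ result)
      where
      combo≈ : ∀ t₁ t₂ → addF (u ⊛ trunc d₁ t₁) (v ⊛ trunc d₂ t₂) ≈ zeroF →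
        EqF p d (addF (term d d₁ u t₁) (term d d₂ v t₂)) zeroF
      combo≈ t₁ t₂ eq = ≈⇒EqF (𝕊.trans
        (+-cong-≈
          (𝕊.trans (≗⇒≈ (term-⊛ d d₁ u t₁)) (⊛-congˡ (trunc d₁ t₁) (cofactor-Deg deg-u)))
          (𝕊.trans (≗⇒≈ (term-⊛ d d₂ v t₂)) (⊛-congˡ (trunc d₂ t₂) (cofactor-Deg deg-v))))
        eq)
      result = independent d u v (combo≈ f₁ f₂ F≈0 , combo≈ g₁ g₂ G≈0)
      vanish : ∀ dt w → Deg dt d w → (dt ≤ d → EqF p (d ∸ dt) w zeroF) → w ≈ zeroF
      vanish dt w deg-w zero-on = coeffs coefficient
        where
        coefficient : ∀ i → w i ≃ 0
        coefficient i with ≤-<-connex (i + dt) d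
        ... | inj₂ d<i+dt = deg-w i d<i+dt
        ... | inj₁ i+dt≤d = EqF⇒≃ (zero-on (≤-trans (m≤n+m dt i) i+dt≤d)) i
          (m+n≤o⇒m≤o∸n i i+dt≤d)

  -- Exponents

  -1≄0 : -1ₚ ≄0
  -1≄0 -1≃0 = 1≄0 (+-≃0ʳ -1≃0 1-1≃0)

  Deg-const : ∀ k a → Deg k k (const a)
  Deg-const k a zero    k<k = ⊥-elim (<-irrefl refl k<k)
  Deg-const k a (suc i) _   = ≃-refl

  Deg-neg : ∀ {k d} f → Deg k d f → Deg k d (-𝟙 ⊛ f)
  Deg-neg f deg = Deg-resp-≈ (𝕊.sym (≗⇒≈ (⊛-const -1ₚ f))) (Deg-scale -1ₚ deg)

  Deg-comm-+ : ∀ k d d′ {f} → Deg k (d + d′) f → Deg k (d′ + d) f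
  Deg-comm-+ k d d′ {f} = subst (λ e → Deg k e f) (+-comm d d′)

  Deg-raise : ∀ {d} e f → Deg 0 d f → Deg e (e + d) f
  Deg-raise {d} e f = Deg-weaken {0} {e} {d} {e + d} ≤-refl

  [1+x]^-⊛ʳ : ∀ c f g → [1+x]^ c · (f ⊛ g) ≈ f ⊛ ([1+x]^ c · g)
  [1+x]^-⊛ʳ c f g = begin
    [1+x]^ c · (f ⊛ g)   ≈⟨ [1+x]^-cong c (𝕊.*-comm f g) ⟩
    [1+x]^ c · (g ⊛ f)   ≈⟨ ≗⇒≈ ([1+x]^-⊛ c g f) ⟩
    ([1+x]^ c · g) ⊛ f   ≈⟨ 𝕊.*-comm ([1+x]^ c · g) f ⟩
    f ⊛ ([1+x]^ c · g)   ∎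
    where open ≈-Reasoning

  minor : Der → Der → Form
  minor (f₁ , g₁) (f₂ , g₂) = (f₁ ⊛ g₂) ⊖ (f₂ ⊛ g₁)

  Low-minor : ∀ {μ d₁ d₂ θ₁ θ₂} → Mem μ d₁ θ₁ → Mem μ d₂ θ₂ → Low (μ₁ μ) (minor θ₁ θ₂)
  Low-minor {θ₁ = f₁ , g₁} {f₂ , g₂} m₁ m₂ = Low-+
    (Low-⊛ˡ f₁ g₂ (Mem.low m₁)) (Low-⊛ʳ -𝟙 (f₂ ⊛ g₁) (Low-⊛ˡ f₂ g₁ (Mem.low m₂)))

  -- The minor is divisible by x^μ₁ y^μ₂ (x + y)^μ₃.
  minor-vanishes : ∀ {μ d₁ d₂ θ₁ θ₂} → Mem μ d₁ θ₁ → Mem μ d₂ θ₂ → d₁ + d₂ < ∣ μ ∣ →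
    minor θ₁ θ₂ ≈ zeroF
  minor-vanishes {μ@(a , b , c)} {d₁} {d₂} {θ₁@(f₁ , g₁)} {θ₂@(f₂ , g₂)} m₁ m₂ small =
    𝕊.trans (𝕊.sym factored) (𝕊.trans ([1+x]^-cong c K≈0) ([1+x]^-zero c))
    where
    open Mem m₁ renaming
      (low to low₁; deg-f to deg-f₁; deg-g to deg-g₁; C to C₁; deg-C to deg-C₁; sum to sum₁)
    open Mem m₂ renaming
      (low to low₂; deg-f to deg-f₂; deg-g to deg-g₂; C to C₂; deg-C to deg-C₂; sum to sum₂)
    K : Form
    -- The minor after the column g is replaced by f + g and (1 + x)^c is taken out of that column.
    K = (f₁ ⊛ C₂) ⊖ (f₂ ⊛ C₁)
    factored : [1+x]^ c · K ≈ minor θ₁ θ₂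
    factored = begin
      [1+x]^ c · K
        ≈⟨ [1+x]^-+ c (f₁ ⊛ C₂) (-𝟙 ⊛ (f₂ ⊛ C₁)) ⟩
      addF ([1+x]^ c · (f₁ ⊛ C₂)) ([1+x]^ c · (-𝟙 ⊛ (f₂ ⊛ C₁)))
        ≈⟨ +-cong-≈ ([1+x]^-⊛ʳ c f₁ C₂) ([1+x]^-⊛ʳ c -𝟙 (f₂ ⊛ C₁)) ⟩
      addF (f₁ ⊛ ([1+x]^ c · C₂)) (-𝟙 ⊛ ([1+x]^ c · (f₂ ⊛ C₁)))
        ≈⟨ +-cong-≈ (⊛-congʳ f₁ (𝕊.sym sum₂))
             (⊛-congʳ -𝟙 (𝕊.trans ([1+x]^-⊛ʳ c f₂ C₁) (⊛-congʳ f₂ (𝕊.sym sum₁)))) ⟩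
      addF (f₁ ⊛ addF f₂ g₂) (-𝟙 ⊛ (f₂ ⊛ addF f₁ g₁))
        ≈⟨ add-column -𝟙 1-1≈0 f₁ g₁ f₂ g₂ ⟩
      minor θ₁ θ₂ ∎
      where open ≈-Reasoning
    deg-minor : Deg b (d₁ + d₂) (minor θ₁ θ₂)
    deg-minor = Deg-+ (Deg-⊛ f₁ g₂ deg-f₁ deg-g₂)
      (Deg-neg (f₂ ⊛ g₁) (Deg-comm-+ b d₂ d₁ (Deg-⊛ f₂ g₁ deg-f₂ deg-g₁)))
    poly : Deg 0 (d₁ + d₂) K
    poly = Deg-drop {c} K (Deg-+ (Deg-⊛ f₁ C₂ deg-f₁ deg-C₂)
      (Deg-neg (f₂ ⊛ C₁) (Deg-comm-+ c d₂ d₁ (Deg-⊛ f₂ C₁ deg-f₂ deg-C₁))))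
    low-K : Low a K
    low-K = Low-+ (Low-⊛ˡ f₁ C₂ low₁) (Low-⊛ʳ -𝟙 (f₂ ⊛ C₁) (Low-⊛ˡ f₂ C₁ low₂))
    K≈0 : K ≈ zeroF
    -- Removing (1 + x)^c from the minor lowers its degree bound d₁ + d₂ - b by c, to a value below
    -- the order a of K.
    K≈0 = Deg∧Low⇒0 (subst (d₁ + d₂ <_) (perm a b c) small)
      (Deg-[1+x]^⁻ c K poly (Deg-resp-≈ (𝕊.sym factored) deg-minor)) low-K
      where
      perm : ∀ a b c → a + b + c ≡ a + (c + b)
      perm = solve-∀

  module _ {μ : Λ} {d₁ d₂ : ℕ} (basis : Basis μ d₁ d₂) where
    open Basis basis

    Basis-nonzero : NonZ (f₁ , g₁)
    Basis-nonzero (f₁≈0 , g₁≈0) =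
      1≄0 (at (proj₁ (indep {v = zeroF} (Deg-const d₁ 1) (λ _ _ → ≃-refl)
        (times f₁ f₂ f₁≈0) (times g₁ g₂ g₁≈0))) 0)
      where
      times : ∀ f t → f ≈ zeroF → addF (const 1 ⊛ f) (zeroF ⊛ t) ≈ zeroF
      times f t f≈0 = +-cong-≈ (𝕊.trans (𝕊.*-identityˡ f) f≈0) (𝕊.zeroˡ t)

    -- With D the minor, -f₂θ₁ + f₁θ₂ = (0, D) and g₂θ₁ - g₁θ₂ = (D, 0). If D were 0, independence
    -- would give f₁ = g₁ = 0, against `Basis-nonzero`.
    Basis-minor-nonzero : ¬ minor (f₁ , g₁) (f₂ , g₂) ≈ zeroF
    Basis-minor-nonzero D≈0 = Basis-nonzero (f₁≈0 , g₁≈0)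
      where
      f₁≈0 : f₁ ≈ zeroF
      f₁≈0 = proj₂ (indep {d₁ + d₂}
        (Deg-neg f₂ (Deg-raise d₁ f₂ (Mem.deg-f mem₂)))
        (Deg-comm-+ d₂ d₂ d₁ (Deg-raise d₂ f₁ (Mem.deg-f mem₁)))
        (𝕊.trans (𝕊.+-comm ((-𝟙 ⊛ f₂) ⊛ f₁) (f₁ ⊛ f₂)) (x*y-y*x≈0 -𝟙 1-1≈0 f₁ f₂))
        (𝕊.trans (expand-minor-g -𝟙 1-1≈0 f₁ g₁ f₂ g₂) D≈0))
      -g₁≈0 : -𝟙 ⊛ g₁ ≈ zeroF
      -g₁≈0 = proj₂ (indep {d₁ + d₂}
        (Deg-raise d₁ g₂ (Deg-drop g₂ (Mem.deg-g mem₂)))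
        (Deg-neg g₁ (Deg-comm-+ d₂ d₂ d₁ (Deg-raise d₂ g₁ (Deg-drop g₁ (Mem.deg-g mem₁)))))
        (𝕊.trans (expand-minor-f -𝟙 1-1≈0 f₁ g₁ f₂ g₂) D≈0)
        (x*y-y*x≈0 -𝟙 1-1≈0 g₂ g₁))
      g₁≈0 : g₁ ≈ zeroF
      g₁≈0 = coeffs λ i → *-≃0 -1≄0
        (≃-trans (≃-sym (≃-reflexive (⊛-const -1ₚ g₁ i))) (at -g₁≈0 i))

    ∣μ∣≤d₁+d₂ : ∣ μ ∣ ≤ d₁ + d₂
    ∣μ∣≤d₁+d₂ = ≮⇒≥ (λ small → Basis-minor-nonzero (minor-vanishes mem₁ mem₂ small))

    minor-multiple : ∀ {e e′ θ θ′} → Mem μ e θ → Mem μ e′ θ′ →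
      Σ[ M ∈ Form ] (Deg (d₁ + d₂) (e + e′) M
        × minor θ θ′ ≈ M ⊛ minor (f₁ , g₁) (f₂ , g₂))
    minor-multiple {e} {e′} {f , g} {f′ , g′} m m′ with span m | span m′
    ... | u , v , deg-u , deg-v , f≈ , g≈ | u′ , v′ , deg-u′ , deg-v′ , f′≈ , g′≈ =
      (u ⊛ v′) ⊖ (u′ ⊛ v) ,
      Deg-+ (Deg-⊛ u v′ deg-u deg-v′)
        (Deg-neg (u′ ⊛ v) (Deg-comm-+ (d₁ + d₂) e′ e (Deg-⊛ u′ v deg-u′ deg-v))) ,
      𝕊.trans (+-cong-≈ (⊛-cong-≈ f≈ g′≈) (⊛-congʳ -𝟙 (⊛-cong-≈ f′≈ g≈)))
        (cramer -𝟙 1-1≈0 u v u′ v′ f₁ g₁ f₂ g₂)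

  -- This and the next two are x^a (x + y)^c ∂ₓ, y^b (x + y)^c ∂_y and x^a y^b (∂ₓ - ∂_y); each
  -- annihilates one of the three linear forms.
  Mem-x-[x+y] : ∀ a b c → Mem (a , b , c) (a + c) ([1+x]^ c · xPow a , zeroF)
  Mem-x-[x+y] a b c = record
    { low   = Low-[1+x]^ c (xPow a) (Low-xPow a)
    ; deg-f = Deg-[1+x]^-drop c (xPow a) (Deg-xPow a c)
    ; deg-g = λ _ _ → ≃-refl
    ; C     = xPow a
    ; deg-C = Deg-xPow a c
    ; sum   = 𝕊.+-identityʳ ([1+x]^ c · xPow a)
    }

  Mem-y-[x+y] : ∀ a b c → Mem (a , b , c) (b + c) (zeroF , [1+x]^ c · const 1)
  Mem-y-[x+y] a b c = record
    { low   = λ _ _ → ≃-refl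
    ; deg-f = λ _ _ → ≃-refl
    ; deg-g = Deg-[1+x]^ c (const 1)
        (subst (λ d → Deg (c + b) d (const 1)) (+-comm c b) (Deg-const (c + b) 1))
    ; C     = const 1
    ; deg-C = Deg-weaken (+-monoˡ-≤ (b + c) (m≤n+m c b)) (Deg-const (b + c) 1)
    ; sum   = 𝕊.refl
    }

  Mem-x-y : ∀ a b c → Mem (a , b , c) (a + b) (xPow a , -𝟙 ⊛ xPow a)
  Mem-x-y a b c = record
    { low   = Low-xPow a
    ; deg-f = Deg-drop (xPow a) (Deg-xPow a b)
    ; deg-g = Deg-neg (xPow a) (Deg-xPow a b)
    ; C     = zeroF
    ; deg-C = λ _ _ → ≃-refl
    ; sum   = 𝕊.trans (coeffs λ i → ≃-trans
        (+-cong-≃ (≃-refl {xPow a i}) (≃-reflexive (⊛-const -1ₚ (xPow a) i)))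
        (a-a≃0 (xPow a i))) (𝕊.sym ([1+x]^-zero c))
    }

  ⊛-lowest-unique : ∀ {a b a′ b′} f g f′ g′ → f ⊛ g ≈ f′ ⊛ g′ → a + b ≡ a′ + b′ →
    Low a f → Low b g → Low a′ f′ → Low b′ g′ → f a * g b ≃ f′ a′ * g′ b′
  ⊛-lowest-unique {a} {b} {a′} {b′} f g f′ g′ eq degrees low-f low-g low-f′ low-g′ = begin
    f a * g b              ≈⟨ ⊛-lowest f g low-f low-g ⟨
    (f ⊛ g) (a + b)        ≡⟨ cong (f ⊛ g) degrees ⟩
    (f ⊛ g) (a′ + b′)      ≈⟨ at eq (a′ + b′) ⟩
    (f′ ⊛ g′) (a′ + b′)    ≈⟨ ⊛-lowest f′ g′ low-f′ low-g′ ⟩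
    f′ a′ * g′ b′          ∎
    where open ≃-Reasoning

  minor-0ʳ : ∀ f₁ g₁ f₂ g₂ → f₂ ⊛ g₁ ≈ zeroF → minor (f₁ , g₁) (f₂ , g₂) ≈ f₁ ⊛ g₂
  minor-0ʳ f₁ g₁ f₂ g₂ eq = 𝕊.trans
    (𝕊.+-congˡ {x = f₁ ⊛ g₂} (𝕊.trans (⊛-congʳ -𝟙 {f₂ ⊛ g₁} {zeroF} eq) (𝕊.zeroʳ -𝟙)))
    (𝕊.+-identityʳ (f₁ ⊛ g₂))

  -- The minor D of a basis divides the minors x^a·(x^a y^b (x+y)^c) and
  -- y^b·(x^a y^b (x+y)^c) of explicit members; the second (its coefficient of
  -- x^a once y = 1) shows that x^(a+1) ∤ D, whence the cofactor of the first
  -- is divisible by x^a, which forces deg D ≤ a + b + c.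
  d₁+d₂≤∣μ∣ : ∀ {μ d₁ d₂} → Basis μ d₁ d₂ → d₁ + d₂ ≤ ∣ μ ∣
  d₁+d₂≤∣μ∣ {a , b , c} {d₁} {d₂} basis = ≮⇒≥ contradiction
    where
    open Basis basis
    D xᵃ -xᵃ Q xᵃQ : Form
    D   = minor (f₁ , g₁) (f₂ , g₂)
    xᵃ  = xPow a
    -xᵃ = -𝟙 ⊛ xᵃ
    Q   = [1+x]^ c · const 1
    xᵃQ = [1+x]^ c · xᵃ
    low-D : Low a D
    low-D = Low-minor mem₁ mem₂
    low-xᵃ : Low a xᵃ
    low-xᵃ = Low-xPow a
    low₁ : Low a xᵃQ
    low₁ = Low-[1+x]^ c xᵃ low-xᵃ
    low₂ : Low a -xᵃ
    low₂ = Low-⊛ʳ -𝟙 xᵃ low-xᵃ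
    xᵃ[a]≃1 : xᵃ a ≃ 1
    xᵃ[a]≃1 = ≃-reflexive (xPow-diag a)
    D[a]≄0 : D a ≄0
    D[a]≄0 D[a]≃0 = 1≄0 (begin
      1             ≈⟨ *-cong-≃ xᵃ[a]≃1 ([1+x]^-lowest c 0 (const 1) (λ _ ())) ⟨
      xᵃ a * Q 0    ≈⟨ ⊛-lowest-unique xᵃ Q M D eq′ (+-comm a 0) low-xᵃ (λ _ ()) (λ _ ()) low-D ⟩
      M 0 * D a     ≈⟨ *-zeroʳ-≃ (M 0) D[a]≃0 ⟩
      0             ∎)
      where
      open ≃-Reasoning
      multiple = minor-multiple basis (Mem-x-y a b c) (Mem-y-[x+y] a b c)
      M : Form
      M = proj₁ multiple
      eq′ : xᵃ ⊛ Q ≈ M ⊛ D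
      eq′ = 𝕊.trans (𝕊.sym (minor-0ʳ xᵃ -xᵃ zeroF Q (𝕊.zeroˡ -xᵃ))) (proj₂ (proj₂ multiple))
    contradiction : ¬ a + b + c < d₁ + d₂
    contradiction large = -1≄0 (begin
      -1ₚ             ≡⟨ trans (*-identityˡ (-1ₚ * 1)) (*-identityʳ -1ₚ) ⟨
      1 * (-1ₚ * 1)
        ≈⟨ *-cong-≃ (≃-trans ([1+x]^-lowest c a xᵃ low-xᵃ) xᵃ[a]≃1)
             (≃-trans (≃-reflexive (⊛-const -1ₚ xᵃ a)) (*-cong-≃ (≃-refl { -1ₚ}) xᵃ[a]≃1)) ⟨
      xᵃQ a * -xᵃ a   ≈⟨ ⊛-lowest-unique xᵃQ -xᵃ M D eq′ refl low₁ low₂ low-M low-D ⟩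
      M a * D a       ≈⟨ *-zeroˡ-≃ (D a) (at M≈0 a) ⟩
      0               ∎)
      where
      open ≃-Reasoning
      multiple = minor-multiple basis (Mem-x-[x+y] a b c) (Mem-x-y a b c)
      M : Form
      M = proj₁ multiple
      eq′ : xᵃQ ⊛ -xᵃ ≈ M ⊛ D
      eq′ = 𝕊.trans (𝕊.sym (minor-0ʳ xᵃQ zeroF xᵃ -xᵃ (𝕊.zeroʳ xᵃ))) (proj₂ (proj₂ multiple))
      low-M : Low a M
      low-M = Low-cancel M D low-D D[a]≄0 (Low-resp-≈ eq′ (Low-⊛ xᵃQ -xᵃ low₁ low₂))
      M≈0 : M ≈ zeroF
      M≈0 = Deg∧Low⇒0 (subst (_< a + (d₁ + d₂)) (perm a b c) (+-monoʳ-< a large))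
        (proj₁ (proj₂ multiple)) low-M
        where
        perm : ∀ a b c → a + (a + b + c) ≡ a + c + (a + b)
        perm = solve-∀

  Basis-swap : ∀ {μ d₁ d₂} → Basis μ d₁ d₂ → Basis μ d₂ d₁
  Basis-swap basis = record
    { mem₁  = mem₂
    ; mem₂  = mem₁
    ; span  = λ m → let u , v , deg-u , deg-v , f≈ , g≈ = span m in
        v , u , deg-v , deg-u ,
        𝕊.trans f≈ (𝕊.+-comm (u ⊛ f₁) (v ⊛ f₂)) , 𝕊.trans g≈ (𝕊.+-comm (u ⊛ g₁) (v ⊛ g₂))
    ; indep = λ {_} {u} {v} deg-u deg-v f≈0 g≈0 →
        let v≈0 , u≈0 = indep deg-v deg-u (𝕊.trans (𝕊.+-comm (v ⊛ f₁) (u ⊛ f₂)) f≈0)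
                          (𝕊.trans (𝕊.+-comm (v ⊛ g₁) (u ⊛ g₂)) g≈0)
        in u≈0 , v≈0
    }
    where open Basis basis

  ordered-basis : ∀ {μ n} → IsΔ p μ n →
    Σ[ d ∈ ℕ ] (Basis μ d (d + n) × d + (d + n) ≡ ∣ μ ∣)
  ordered-basis {μ} (d₁ , d₂ , exponents , refl) with ≤-total d₁ d₂
  ... | inj₁ d₁≤d₂ = d₁ , ordered , ≤-antisym (d₁+d₂≤∣μ∣ ordered) (∣μ∣≤d₁+d₂ ordered)
    where
    ordered : Basis μ d₁ (d₁ + ∣ d₁ - d₂ ∣)
    ordered = subst (Basis μ d₁)
      (trans (sym (m+[n∸m]≡n d₁≤d₂)) (cong (d₁ +_) (sym (m≤n⇒∣m-n∣≡n∸m d₁≤d₂))))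
      (Exponents⇒Basis exponents)
  ... | inj₂ d₂≤d₁ = d₂ , ordered , ≤-antisym (d₁+d₂≤∣μ∣ ordered) (∣μ∣≤d₁+d₂ ordered)
    where
    ordered : Basis μ d₂ (d₂ + ∣ d₁ - d₂ ∣)
    ordered = subst (Basis μ d₂)
      (trans (sym (m+[n∸m]≡n d₂≤d₁)) (cong (d₂ +_) (sym (m≤n⇒∣n-m∣≡n∸m d₂≤d₁))))
      (Basis-swap (Exponents⇒Basis exponents))

  Deg-small⇒0 : ∀ {k d f} → d < k → Deg k d f → f ≈ zeroF
  Deg-small⇒0 d<k deg = Deg∧Low⇒0 {a = 0} d<k deg (λ _ ())

  module _ {μ : Λ} {n : ℕ} (isΔ : IsΔ p μ n) where

    -- A member of degree below both exponents has zero cofactors. So d is at least the smaller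
    -- exponent, which is half of ∣μ∣ - n.
    ∣μ∣≤2d+Δ : ∀ {d θ} → Mem μ d θ → NonZ θ → ∣ μ ∣ ≤ 2 * d + n
    ∣μ∣≤2d+Δ {d} m nonzero with ordered-basis isΔ
    ... | d₁ , basis , eq with ≤-<-connex d₁ d
    ... | inj₁ d₁≤d = begin
      ∣ μ ∣          ≡⟨ eq ⟨
      d₁ + (d₁ + n)  ≤⟨ +-mono-≤ d₁≤d (+-monoˡ-≤ n d₁≤d) ⟩
      d + (d + n)    ≡⟨ double d n ⟩
      2 * d + n      ∎
      where
      open ≤-Reasoning
      double : ∀ d n → d + (d + n) ≡ 2 * d + n
      double = solve-∀
    ... | inj₂ d<d₁ with Basis.span basis m
    ...   | u , v , deg-u , deg-v , f≈ , g≈ = ⊥-elim (nonzero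
      (𝕊.trans f≈ (combination f₁ f₂) , 𝕊.trans g≈ (combination g₁ g₂)))
      where
      open Basis basis
      combination : ∀ s t → addF (u ⊛ s) (v ⊛ t) ≈ zeroF
      combination s t = +-cong-≈
        (𝕊.trans (⊛-congˡ s (Deg-small⇒0 d<d₁ deg-u)) (𝕊.zeroˡ s))
        (𝕊.trans (⊛-congˡ t (Deg-small⇒0 (<-≤-trans d<d₁ (m≤m+n d₁ n)) deg-v)) (𝕊.zeroˡ t))

    minimal-member : Σ[ d ∈ ℕ ] Σ[ θ ∈ Der ] (Mem μ d θ × NonZ θ × 2 * d + n ≡ ∣ μ ∣)
    minimal-member with ordered-basis isΔ
    ... | d , basis , eq = d , _ , Basis.mem₁ basis , Basis-nonzero basis , trans (double d n) eq
      where
      double : ∀ d n → 2 * d + n ≡ d + (d + n)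
      double = solve-∀

    -- As 0 < n, the second basis element has degree above d, and the cofactor of the first one is a
    -- constant.
    minimal-members-proportional : ∀ {d} → 0 < n → 2 * d + n ≡ ∣ μ ∣ →
      Σ[ F ∈ Form ] Σ[ G ∈ Form ] (∀ {f g} → Mem μ d (f , g) →
        Σ[ k ∈ ℕ ] (f ≈ (λ i → k * F i) × g ≈ (λ i → k * G i)))
    minimal-members-proportional {d} 0<n eq with ordered-basis isΔ
    ... | d₁ , basis , eq₁ = f₁ , g₁ , multiple
      where
      open Basis basis
      double : ∀ d n → 2 * d + n ≡ d + (d + n)
      double = solve-∀
      d≡d₁ : d ≡ d₁
      d≡d₁ = *-cancelˡ-≡ d d₁ 2 (+-cancelʳ-≡ n (2 * d) (2 * d₁)
        (trans eq (trans (sym eq₁) (sym (double d₁ n)))))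
      multiple : ∀ {f g} → Mem μ d (f , g) →
        Σ[ k ∈ ℕ ] (f ≈ (λ i → k * f₁ i) × g ≈ (λ i → k * g₁ i))
      multiple m with span m
      ... | u , v , deg-u , deg-v , f≈ , g≈ =
        u 0 , 𝕊.trans f≈ (combination f₁ f₂) , 𝕊.trans g≈ (combination g₁ g₂)
        where
        u≈ : u ≈ const (u 0)
        u≈ = coeffs λ where
          zero    → ≃-refl
          (suc i) → deg-u (suc i) (subst (_< suc i + d₁) (sym d≡d₁) (s≤s (m≤n+m d₁ i)))
        v≈0 : v ≈ zeroF
        v≈0 = Deg-small⇒0 (subst (_< d₁ + n) (sym d≡d₁) (m<m+n d₁ 0<n)) deg-v
        combination : ∀ s t → addF (u ⊛ s) (v ⊛ t) ≈ (λ i → u 0 * s i)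
        combination s t = 𝕊.trans
          (+-cong-≈ (𝕊.trans (⊛-congˡ s u≈) (≗⇒≈ (⊛-const (u 0) s)))
            (𝕊.trans (⊛-congˡ t v≈0) (𝕊.zeroˡ t)))
          (𝕊.+-identityʳ _)

  -- Members along edges of Λ and in small degree

  Deg-x· : ∀ {k d} f → Deg k d f → Deg k (suc d) (x· f)
  Deg-x· f deg zero    _           = ≃-refl
  Deg-x· f deg (suc i) (s≤s d<i+k) = deg i d<i+k

  Deg-[1+x]-suc : ∀ {k d} f → Deg k d f → Deg k (suc d) ([1+x] f)
  Deg-[1+x]-suc {k} {d} f deg = Deg-[1+x] f
    (Deg-weaken {k} {suc k} {d} {suc d} (≤-reflexive (sym (+-suc k d))) deg)

  Deg-suc : ∀ {k d} f → Deg k d f → Deg k (suc d) f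
  Deg-suc f deg i 1+d<i+k = deg i (<-trans (n<1+n _) 1+d<i+k)

  Deg-suc-suc : ∀ {k d} f → Deg k d f → Deg (suc k) (suc d) f
  Deg-suc-suc {k} {d} f deg i 1+d<i+1+k =
    deg i (≤-pred (subst (suc d <_) (+-suc i k) 1+d<i+1+k))

  Deg-pred : ∀ {k d} f → Deg (suc k) (suc d) f → Deg k d f
  Deg-pred {k} {d} f deg i d<i+k = deg i (subst (suc d <_) (sym (+-suc i k)) (s≤s d<i+k))

  Deg-predˡ : ∀ {k d} f → Deg (suc k) d f → Deg k d f
  Deg-predˡ {k} {d} f deg i d<i+k = deg i (<-trans d<i+k (+-monoʳ-< i (n<1+n k)))

  x·-cong : ∀ {f g} → f ≈ g → x· f ≈ x· g
  x·-cong f≈g = coeffs λ where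
    zero    → ≃-refl
    (suc i) → at f≈g i

  [1+x]^-suc : ∀ c f → [1+x]^ suc c · f ≡ [1+x]^ c · ([1+x] f)
  [1+x]^-suc zero    f = refl
  [1+x]^-suc (suc c) f = cong [1+x]_ ([1+x]^-suc c f)

  -- Multiplication by αᵢ. For α₂ = y the coefficients stay the same at y = 1 and only the degree is
  -- raised.
  Mem-addE : ∀ i {μ d θ} → Mem μ d θ → NonZ θ →
    Σ[ θ′ ∈ Der ] (Mem (addE i μ) (suc d) θ′ × NonZ θ′)
  Mem-addE zero {a , b , c} {θ = f , g} m nonzero = (x· f , x· g) , record
    { low   = λ { zero _ → ≃-refl ; (suc i) (s≤s i<a) → low i i<a }
    ; deg-f = Deg-x· f deg-f
    ; deg-g = Deg-x· g deg-g
    ; C     = x· C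
    ; deg-C = Deg-x· C deg-C
    ; sum   = 𝕊.trans (coeffs λ { zero → ≃-refl ; (suc i) → ≃-refl })
        (𝕊.trans (x·-cong sum) (𝕊.sym ([1+x]^-x· c C)))
    } , λ (xf≈0 , xg≈0) → nonzero (coeffs (at xf≈0 ∘ suc) , coeffs (at xg≈0 ∘ suc))
    where open Mem m
  Mem-addE (suc zero) {θ = f , g} m nonzero = (f , g) , record
    { low   = low
    ; deg-f = Deg-suc f deg-f
    ; deg-g = Deg-suc-suc g deg-g
    ; C     = C
    ; deg-C = Deg-suc C deg-C
    ; sum   = sum
    } , nonzero
    where open Mem m
  Mem-addE (suc (suc zero)) {a , b , c} {θ = f , g} m nonzero = ([1+x] f , [1+x] g) , record
    { low   = Low-[1+x]^ 1 f low
    ; deg-f = Deg-[1+x]-suc f deg-f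
    ; deg-g = Deg-[1+x]-suc g deg-g
    ; C     = C
    ; deg-C = Deg-suc-suc C deg-C
    ; sum   = 𝕊.trans (𝕊.sym ([1+x]^-+ 1 f g)) ([1+x]-cong sum)
    } , λ (f≈0 , g≈0) → nonzero ([1+x]^-≈0 1 f f≈0 , [1+x]^-≈0 1 g g≈0)
    where open Mem m

  Mem-addE⁻ : ∀ i {μ d θ} → Mem (addE i μ) d θ → Mem μ d θ
  Mem-addE⁻ zero m = record { Mem m ; low = λ i i<a → Mem.low m i (m<n⇒m<1+n i<a) }
  Mem-addE⁻ (suc zero) {θ = f , g} m = record { Mem m ; deg-g = Deg-predˡ g (Mem.deg-g m) }
  Mem-addE⁻ (suc (suc zero)) {a , b , c} m = record
    { low = low ; deg-f = deg-f ; deg-g = deg-g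
    ; C     = [1+x] C
    ; deg-C = Deg-[1+x] C deg-C
    ; sum   = 𝕊.trans sum (≗⇒≈ λ i → cong (λ h → h i) ([1+x]^-suc c C))
    }
    where open Mem m

  Mem-subE : ∀ i {μ d θ} → Mem μ d θ → Mem (subE i μ) d θ
  Mem-subE i {μ} {d} {θ} m with subE-cases i μ
  ... | inj₁ eq = Mem-addE⁻ i (subst (λ ν → Mem ν d θ) eq m)
  ... | inj₂ eq = subst (λ ν → Mem ν d θ) (sym eq) m

  -- From d < a follows f = 0, so g is divisible by y^b (x + y)^c, of degree above d. The next two
  -- lemmas run the same argument from the other two lines.
  Mem-small₁ : ∀ {a b c d f g} → Mem (a , b , c) d (f , g) → d < a → d < b + c →
    f ≈ zeroF × g ≈ zeroF
  Mem-small₁ {a} {b} {c} {d} {f} {g} m d<a d<b+c = f≈0 , g≈0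
    where
    open Mem m
    f≈0 : f ≈ zeroF
    f≈0 = Deg∧Low⇒0 (subst (d <_) (sym (+-identityʳ a)) d<a) deg-f low
    g≈ : g ≈ [1+x]^ c · C
    g≈ = 𝕊.trans (+-cong-≈ (𝕊.sym f≈0) (𝕊.refl {g})) sum
    C≈0 : C ≈ zeroF
    C≈0 = Deg-small⇒0 (subst (d <_) (+-comm b c) d<b+c)
      (Deg-[1+x]^⁻ c C (Deg-drop C deg-C) (Deg-resp-≈ g≈ deg-g))
    g≈0 : g ≈ zeroF
    g≈0 = 𝕊.trans g≈ (𝕊.trans ([1+x]^-cong c C≈0) ([1+x]^-zero c))

  Mem-small₂ : ∀ {a b c d f g} → Mem (a , b , c) d (f , g) → d < b → d < a + c →
    f ≈ zeroF × g ≈ zeroF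
  Mem-small₂ {a} {b} {c} {d} {f} {g} m d<b d<a+c = f≈0 , g≈0
    where
    open Mem m
    g≈0 : g ≈ zeroF
    g≈0 = Deg-small⇒0 d<b deg-g
    f≈ : f ≈ [1+x]^ c · C
    f≈ = 𝕊.trans (𝕊.sym (𝕊.trans (+-cong-≈ (𝕊.refl {f}) g≈0) (𝕊.+-identityʳ f))) sum
    C≈0 : C ≈ zeroF
    C≈0 = Deg∧Low⇒0 d<a+c deg-C (Low-[1+x]^⁻ c C (Low-resp-≈ f≈ low))
    f≈0 : f ≈ zeroF
    f≈0 = 𝕊.trans f≈ (𝕊.trans ([1+x]^-cong c C≈0) ([1+x]^-zero c))

  Mem-small₃ : ∀ {a b c d f g} → Mem (a , b , c) d (f , g) → d < c → d < a + b →
    f ≈ zeroF × g ≈ zeroF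
  Mem-small₃ {a} {b} {c} {d} {f} {g} m d<c d<a+b =
    f≈0 , coeffs (λ i → +-≃0ˡ (at f≈0 i) (at f+g≈0 i))
    where
    open Mem m
    f+g≈0 : addF f g ≈ zeroF
    f+g≈0 = 𝕊.trans sum (𝕊.trans ([1+x]^-cong c (Deg-small⇒0 d<c deg-C)) ([1+x]^-zero c))
    f≈0 : f ≈ zeroF
    f≈0 = Deg∧Low⇒0 {b} d<a+b (λ i d<i+b → +-≃0ʳ (deg-g i d<i+b) (at f+g≈0 i)) low

  -- Frobenius, its inverse and derivations on members

  inflate-addF : ∀ f g → addF (inflate f) (inflate g) ≗ inflate (addF f g)
  inflate-addF f g i with p ∣? i
  ... | yes _ = refl
  ... | no  _ = refl

  inflate-vanish : ∀ {f i} → (∀ q → i ≡ q * p → f q ≃ 0) → inflate f i ≃ 0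
  inflate-vanish {f} {i} vanish with p ∣? i
  ... | yes (divides q eq) = vanish q eq
  ... | no  _              = ≃-refl

  Deg-inflate : ∀ {k d} f → Deg k d f → Deg (p * k) (p * d) (inflate f)
  Deg-inflate {k} {d} f deg i pd<i+pk = inflate-vanish {f} λ
    { q refl → deg q (*-cancelˡ-< p d (q + k) (subst (p * d <_) (factor p q k) pd<i+pk)) }
    where
    factor : ∀ p q k → q * p + p * k ≡ p * (q + k)
    factor = solve-∀

  inflate-≈0 : ∀ {f} → inflate f ≈ zeroF → f ≈ zeroF
  inflate-≈0 {f} eq = coeffs λ i → ≃-trans (≃-sym (≃-reflexive (inflate-* f i))) (at eq (i * p))

  Mem-inflate : ∀ {μ d f g} → Mem μ d (f , g) → Mem (scale p μ) (p * d) (inflate f , inflate g)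
  Mem-inflate {a , b , c} {d} {f} {g} m = record
    { low   = λ i i<pa → inflate-vanish {f} λ where
        q refl → low q (*-cancelʳ-< p q a (subst (q * p <_) (*-comm p a) i<pa))
    ; deg-f = subst (λ k → Deg k (p * d) (inflate f)) (*-zeroʳ p) (Deg-inflate f deg-f)
    ; deg-g = Deg-inflate g deg-g
    ; C     = inflate C
    ; deg-C = Deg-inflate C deg-C
    ; sum   = 𝕊.trans (≗⇒≈ (inflate-addF f g)) (𝕊.trans (inflate-cong sum)
        (subst (λ k → inflate ([1+x]^ c · C) ≈ [1+x]^ k · inflate C) (*-comm c p)
          (𝕊.sym (inflate-[1+x]^ c C))))
    }
    where open Mem m

  deflate : Form → Form
  deflate f i = f (i * p)

  inflate-deflate : ∀ {f} → x∂ f ≈ zeroF → f ≈ inflate (deflate f)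
  inflate-deflate {f} x∂f≈0 = coeffs coefficient
    where
    coefficient : ∀ i → f i ≃ inflate (deflate f) i
    coefficient i with p ∣? i
    ... | yes (divides q refl) = ≃-refl
    ... | no  p∤i              = x∂≈0⇒∤ x∂f≈0 i p∤i

  Deg-deflate : ∀ {k d} f → Deg (k * p) (d * p) f → Deg k d (deflate f)
  Deg-deflate {k} {d} f deg i d<i+k = deg (i * p)
    (subst (d * p <_) (*-distribʳ-+ p i k) (*-monoˡ-< p d<i+k))

  -- When C is a series in x^p, so is (1 + x)^(c p) C, because (1 + x)^p = 1 + x^p; comparing
  -- coefficients at the multiples of p gives the relation for the deflated triple.
  Mem-deflate : ∀ {a b c d f g} (m : Mem (a * p , b * p , c * p) (d * p) (f , g)) →
    x∂ (Mem.C m) ≈ zeroF → Mem (a , b , c) d (deflate f , deflate g)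
  Mem-deflate {a} {b} {c} {d} {f} {g} m x∂C≈0 = record
    { low   = λ i i<a → low (i * p) (*-monoˡ-< p i<a)
    ; deg-f = Deg-deflate f deg-f
    ; deg-g = Deg-deflate g deg-g
    ; C     = deflate C
    ; deg-C = Deg-deflate C deg-C
    ; sum   = coeffs λ i → ≃-trans (at f+g≈ (i * p))
        (≃-reflexive (inflate-* ([1+x]^ c · deflate C) i))
    }
    where
    open Mem m
    f+g≈ : addF f g ≈ inflate ([1+x]^ c · deflate C)
    f+g≈ = 𝕊.trans sum (𝕊.trans ([1+x]^-cong (c * p) (inflate-deflate x∂C≈0))
      (inflate-[1+x]^ c (deflate C)))

  -- x∂ₓ respects divisibility by x^a and by y^b, and costs at most one factor x + y.
  Mem-x∂ : ∀ {a b c d f g} → Mem (a , b , c) d (f , g) → Mem (a , b , c ∸ 1) d (x∂ f , x∂ g)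
  Mem-x∂ {a} {b} {c} {d} {f} {g} m = record
    { low   = λ i i<a → *-zeroʳ-≃ i (low i i<a)
    ; deg-f = Deg-x∂ f deg-f
    ; deg-g = Deg-x∂ g deg-g
    ; C     = proj₁ (quotient c C deg-C sum)
    ; deg-C = proj₁ (proj₂ (quotient c C deg-C sum))
    ; sum   = 𝕊.trans (≗⇒≈ (λ i → sym (*-distribˡ-+ i (f i) (g i))))
        (proj₂ (proj₂ (quotient c C deg-C sum)))
    }
    where
    open Mem m
    Deg-x∂ : ∀ {k d} f → Deg k d f → Deg k d (x∂ f)
    Deg-x∂ f deg i d<i+k = *-zeroʳ-≃ i (deg i d<i+k)
    quotient : ∀ c C {h} → Deg c d C → h ≈ [1+x]^ c · C →
      Σ[ K ∈ Form ] (Deg (c ∸ 1) d K × x∂ h ≈ [1+x]^ (c ∸ 1) · K)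
    quotient zero    C deg h≈ = x∂ C , Deg-x∂ C deg ,
      coeffs λ i → *-cong-≃ (≃-refl {i}) (at h≈ i)
    quotient (suc c) C deg h≈ = x· K , Deg-xK ,
      𝕊.trans (coeffs λ i → *-cong-≃ (≃-refl {i}) (at h≈ i)) (x∂-[1+x]^ c C)
      where
      K : Form
      K = addF (λ i → suc c * C i) ([1+x]∂ C)
      Deg-xK : Deg c d (x· K)
      Deg-xK zero    _       = ≃-refl
      Deg-xK (suc i) d<1+i+c = +-zero-≃ (*-zeroʳ-≃ (suc c) (deg i d<i+1+c))
        (+-zero-≃ (*-zeroʳ-≃ i (deg i d<i+1+c))
          (*-zeroʳ-≃ (suc i) (deg (suc i) (m<n⇒m<1+n d<i+1+c))))
        where
        d<i+1+c : d < i + suc c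
        d<i+1+c = subst (d <_) (sym (+-suc i c)) d<1+i+c

  Deg-[1+x]∂ : ∀ {k d} f → Deg k d f → Deg k d ([1+x]∂ f)
  Deg-[1+x]∂ f deg i d<i+k =
    +-zero-≃ (*-zeroʳ-≃ i (deg i d<i+k)) (*-zeroʳ-≃ (suc i) (deg (suc i) (m<n⇒m<1+n d<i+k)))

  -- (x + y)∂ₓ respects divisibility by y^b and by (x + y)^c, and costs at most one factor x.
  Mem-[1+x]∂ : ∀ {a b c d f g} → Mem (a , b , c) d (f , g) →
    Mem (a ∸ 1 , b , c) d ([1+x]∂ f , [1+x]∂ g)
  Mem-[1+x]∂ {a} {b} {c} {d} {f} {g} m = record
    { low   = Low-[1+x]∂ a low
    ; deg-f = Deg-[1+x]∂ f deg-f
    ; deg-g = Deg-[1+x]∂ g deg-g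
    ; C     = addF (λ i → c * C i) ([1+x]∂ C)
    ; deg-C = Deg-+ (Deg-scale c deg-C) (Deg-[1+x]∂ C deg-C)
    ; sum   = 𝕊.trans (≗⇒≈ λ i → additive i (f i) (g i) (f (suc i)) (g (suc i)))
        (𝕊.trans ([1+x]∂-cong sum) ([1+x]∂-[1+x]^ c C))
    }
    where
    open Mem m
    Low-[1+x]∂ : ∀ a → Low a f → Low (a ∸ 1) ([1+x]∂ f)
    Low-[1+x]∂ (suc a) low i i<a = +-zero-≃
      (*-zeroʳ-≃ i (low i (m<n⇒m<1+n i<a))) (*-zeroʳ-≃ (suc i) (low (suc i) (s≤s i<a)))
    additive : ∀ i x y x′ y′ → i * x + suc i * x′ + (i * y + suc i * y′)
      ≡ i * (x + y) + suc i * (x′ + y′)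
    additive = solve-∀

  -- The first relation puts the support of f in a single residue class
  -- mod p; the second, at the index before a nonzero coefficient, shows that
  -- this class is 0.
  eigenvector-of-x∂-and-[1+x]∂ : ∀ {f k l k′ l′} → k ≄0 → k′ ≄0 →
    (∀ i → k * x∂ f i ≃ l * f i) → (∀ i → k′ * [1+x]∂ f i ≃ l′ * f i) → x∂ f ≈ zeroF
  eigenvector-of-x∂-and-[1+x]∂ {f} {k} {l} {k′} {l′} k≄0 k′≄0 eq eq′ = coeffs coefficient
    where
    eigenvalue : ∀ i → f i ≄0 → k * i ≃ l
    eigenvalue i fi≄0 = *-cancelʳ-≃ (f i) fi≄0 (≃-trans (≃-reflexive (*-assoc k i (f i))) (eq i))
    coefficient : ∀ i → i * f i ≃ 0
    coefficient zero = ≃-refl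
    coefficient (suc i) with ≃0? (f (suc i)) | ≃0? (f i)
    ... | yes f[1+i]≃0 | _        = *-zeroʳ-≃ (suc i) f[1+i]≃0
    ... | no  f[1+i]≄0 | yes fi≃0 = *-≃0 k′≄0 (≃-trans
      (*-cong-≃ (≃-refl {k′}) (+-cong-≃ (≃-sym (*-zeroʳ-≃ i fi≃0)) (≃-refl {suc i * f (suc i)})))
      (≃-trans (eq′ i) (*-zeroʳ-≃ l′ fi≃0)))
    ... | no  f[1+i]≄0 | no  fi≄0 = ⊥-elim (k≄0 (+-≃0ʳ ≃-refl (+-cancelˡ-≃ (k * i) (begin
      k * i + (k + 0)   ≡⟨ next k i ⟩
      k * suc i         ≈⟨ eigenvalue (suc i) f[1+i]≄0 ⟩
      l                 ≈⟨ eigenvalue i fi≄0 ⟨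
      k * i             ≡⟨ +-identityʳ (k * i) ⟨
      k * i + 0         ∎))))
      where
      open ≃-Reasoning
      next : ∀ k i → k * i + (k + 0) ≡ k * suc i
      next = solve-∀

  -- Apply (1 + x)∂ to h = (1 + x)^c C and cancel (1 + x)^c. The equation serves twice: to show p ∣
  -- c at a peak, and then that C is a series in x^p.
  x∂≈0⇒quotient : ∀ c C {h} → x∂ h ≈ zeroF → h ≈ [1+x]^ c · C →
    addF (λ i → c * C i) ([1+x]∂ C) ≈ zeroF
  x∂≈0⇒quotient c C x∂h≈0 h≈ = [1+x]^-≈0 c _
    (𝕊.trans (𝕊.sym ([1+x]∂-[1+x]^ c C))
      (𝕊.trans ([1+x]∂-cong (𝕊.sym h≈)) (x∂≈0⇒[1+x]∂≈0 x∂h≈0)))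

  -- Peaks of Δ

  module Peaks (Δ : Λ → ℕ) (isΔ : ∀ μ → IsΔ p μ (Δ μ)) where

    Peak : Λ → Set
    Peak ζ = ∀ ν → Adjacent ζ ν → Δ ν < Δ ζ

    ∣∣≤2d+Δ : ∀ {μ d θ} → Mem μ d θ → NonZ θ → ∣ μ ∣ ≤ 2 * d + Δ μ
    ∣∣≤2d+Δ {μ} = ∣μ∣≤2d+Δ (isΔ μ)

    -- Multiplying a minimal member by αᵢ raises both its degree and ∣μ∣ by 1, so ∣μ∣ - 2d falls by
    -- 1.
    Δ-step-≤ : ∀ i μ → Δ μ ≤ suc (Δ (addE i μ))
    Δ-step-≤ i μ with minimal-member (isΔ μ)
    ... | d , θ , m , nonzero , eq with Mem-addE i m nonzero
    ... | θ′ , m′ , nonzero′ = +-cancelˡ-≤ (suc (2 * d)) _ _ (begin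
      suc (2 * d) + Δ μ               ≡⟨ cong suc eq ⟩
      suc ∣ μ ∣                       ≡⟨ ∣addE∣ i μ ⟨
      ∣ addE i μ ∣                    ≤⟨ ∣∣≤2d+Δ m′ nonzero′ ⟩
      2 * suc d + Δ (addE i μ)        ≡⟨ shift d (Δ (addE i μ)) ⟩
      suc (2 * d) + suc (Δ (addE i μ)) ∎)
      where
      open ≤-Reasoning
      shift : ∀ d n → 2 * suc d + n ≡ suc (2 * d) + suc n
      shift = solve-∀

    Δ-addE-≤ : ∀ i μ → Δ (addE i μ) ≤ suc (Δ μ)
    Δ-addE-≤ i μ with minimal-member (isΔ (addE i μ))
    ... | d , θ , m , nonzero , eq = +-cancelˡ-≤ (2 * d) _ _ (begin
      2 * d + Δ (addE i μ)   ≡⟨ eq ⟩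
      ∣ addE i μ ∣           ≡⟨ ∣addE∣ i μ ⟩
      suc ∣ μ ∣              ≤⟨ s≤s (∣∣≤2d+Δ (Mem-addE⁻ i m) nonzero) ⟩
      suc (2 * d + Δ μ)      ≡⟨ +-suc (2 * d) (Δ μ) ⟨
      2 * d + suc (Δ μ)      ∎)
      where open ≤-Reasoning

    -- Δ μ has the parity of ∣μ∣, which changes along an edge.
    Δ-addE-≢ : ∀ i μ → Δ (addE i μ) ≢ Δ μ
    Δ-addE-≢ i μ same with minimal-member (isΔ (addE i μ)) | minimal-member (isΔ μ)
    ... | d , _ , _ , _ , eq | d′ , _ , _ , _ , eq′ =
      even≢odd d d′ (+-cancelʳ-≡ (Δ μ) (2 * d) (suc (2 * d′)) (begin
        2 * d + Δ μ            ≡⟨ cong (2 * d +_) same ⟨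
        2 * d + Δ (addE i μ)   ≡⟨ eq ⟩
        ∣ addE i μ ∣           ≡⟨ ∣addE∣ i μ ⟩
        suc ∣ μ ∣              ≡⟨ cong suc eq′ ⟨
        suc (2 * d′) + Δ μ     ∎))
      where open ≡-Reasoning

    Δ-adjacent-≤ : ∀ {μ ν} → Adjacent μ ν → Δ μ ≤ suc (Δ ν)
    Δ-adjacent-≤ {ν = ν} (i , inj₁ refl) = Δ-addE-≤ i ν
    Δ-adjacent-≤ {μ} (i , inj₂ refl) = Δ-step-≤ i μ

    Δ-adjacent-≢ : ∀ {μ ν} → Adjacent μ ν → Δ μ ≢ Δ ν
    Δ-adjacent-≢ {ν = ν} (i , inj₁ refl) = Δ-addE-≢ i ν
    Δ-adjacent-≢ {μ} (i , inj₂ refl) = Δ-addE-≢ i μ ∘ sym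

    p*Δ≤Δ-scale : ∀ μ → p * Δ μ ≤ Δ (scale p μ)
    p*Δ≤Δ-scale μ with minimal-member (isΔ μ)
    ... | d , (f , g) , m , nonzero , eq = +-cancelˡ-≤ (2 * (p * d)) _ _ (begin
      2 * (p * d) + p * Δ μ          ≡⟨ factor p d (Δ μ) ⟩
      p * (2 * d + Δ μ)              ≡⟨ cong (p *_) eq ⟩
      p * ∣ μ ∣                      ≡⟨ ∣scale∣ p μ ⟨
      ∣ scale p μ ∣
        ≤⟨ ∣∣≤2d+Δ (Mem-inflate m) (λ (F≈0 , G≈0) → nonzero (inflate-≈0 F≈0 , inflate-≈0 G≈0)) ⟩
      2 * (p * d) + Δ (scale p μ)    ∎)
      where
      open ≤-Reasoning
      factor : ∀ p d n → 2 * (p * d) + p * n ≡ p * (2 * d + n)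
      factor = solve-∀

    -- θ is a member of minimal degree d at a peak ζ with Δ ζ ≥ 2. Both θ and
    -- its derivatives x∂θ, (1 + x)∂θ have degree d in D(ζ − e₃), D(ζ − e₁), where
    -- the space of members of degree d is a line; hence x∂θ = 0.
    module _ {a b c : ℕ} (peak : Peak (a , b , c)) (2≤Δ : 2 ≤ Δ (a , b , c))
        {d : ℕ} {f g : Form} (m : Mem (a , b , c) d (f , g)) (nonzero : NonZ (f , g))
        (eq : 2 * d + Δ (a , b , c) ≡ ∣ a , b , c ∣) where
      private
        ζ : Λ
        ζ = a , b , c

      -- The size grows while Δ drops, so the least degree at ζ + eᵢ exceeds d.
      no-member-above : ∀ i {θ} → Mem (addE i ζ) d θ → ¬ NonZ θ
      no-member-above i m′ nonzero′ = <-irrefl refl (begin-strict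
        ∣ ζ ∣                      <⟨ n<1+n ∣ ζ ∣ ⟩
        suc ∣ ζ ∣                  ≡⟨ ∣addE∣ i ζ ⟨
        ∣ addE i ζ ∣               ≤⟨ ∣∣≤2d+Δ m′ nonzero′ ⟩
        2 * d + Δ (addE i ζ)       ≤⟨ +-monoʳ-≤ (2 * d) (<⇒≤ (peak (addE i ζ) (i , inj₂ refl))) ⟩
        2 * d + Δ ζ                ≡⟨ eq ⟩
        ∣ ζ ∣                      ∎)
        where open ≤-Reasoning

      -- Δ and the size both drop by 1, so d remains the least degree at ζ - eᵢ; on a wall the point
      -- is ζ itself. Positivity is where 2 ≤ Δ ζ enters.
      below : ∀ i → 0 < Δ (subE i ζ) × 2 * d + Δ (subE i ζ) ≡ ∣ subE i ζ ∣
      below i with subE-cases i ζ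
      ... | inj₂ same = subst (λ ν → 0 < Δ ν × 2 * d + Δ ν ≡ ∣ ν ∣) (sym same) (<⇒≤ 2≤Δ , eq)
      ... | inj₁ ζ≡ = ≤-pred (subst (2 ≤_) Δζ≡ 2≤Δ) , suc-injective (begin
        suc (2 * d + Δ (subE i ζ))   ≡⟨ +-suc (2 * d) _ ⟨
        2 * d + suc (Δ (subE i ζ))   ≡⟨ cong (2 * d +_) Δζ≡ ⟨
        2 * d + Δ ζ                  ≡⟨ eq ⟩
        ∣ ζ ∣                        ≡⟨ cong ∣_∣ ζ≡ ⟩
        ∣ addE i (subE i ζ) ∣        ≡⟨ ∣addE∣ i (subE i ζ) ⟩
        suc ∣ subE i ζ ∣             ∎)
        where
        open ≡-Reasoning
        adj : Adjacent ζ (subE i ζ)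
        adj = i , inj₁ ζ≡
        Δζ≡ : Δ ζ ≡ suc (Δ (subE i ζ))
        Δζ≡ = ≤-antisym (Δ-adjacent-≤ adj) (peak (subE i ζ) adj)

      no-member-below : ∀ i {e θ} → suc e ≡ d → Mem (subE i ζ) e θ → ¬ NonZ θ
      no-member-below i {e} refl m′ nonzero′ = <-irrefl refl (begin-strict
        2 * e + Δ (subE i ζ)       <⟨ +-monoˡ-< (Δ (subE i ζ)) (*-monoʳ-< 2 (n<1+n e)) ⟩
        2 * suc e + Δ (subE i ζ)   ≡⟨ proj₂ (below i) ⟩
        ∣ subE i ζ ∣               ≤⟨ ∣∣≤2d+Δ m′ nonzero′ ⟩
        2 * e + Δ (subE i ζ)       ∎)
        where open ≤-Reasoning

      -- Both members are multiples k and l of one fixed member, and k is nonzero because θ is.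
      -- Cross-multiplication avoids inverting k.
      proportional : ∀ i {f′ g′} → Mem (subE i ζ) d (f′ , g′) → Σ[ k ∈ ℕ ] Σ[ l ∈ ℕ ]
        (k ≄0 × (∀ j → k * f′ j ≃ l * f j) × (∀ j → k * g′ j ≃ l * g j))
      proportional i {f′} {g′} m′
        with minimal-members-proportional (isΔ (subE i ζ)) (proj₁ (below i)) (proj₂ (below i))
      ... | F , G , multiple with multiple (Mem-subE i m) | multiple m′
      ... | k , f≈ , g≈ | l , f′≈ , g′≈ = k , l , k≄0 , cross f≈ f′≈ , cross g≈ g′≈
        where
        k≄0 : k ≄0
        k≄0 k≃0 = nonzero
          ( 𝕊.trans f≈ (coeffs λ j → *-zeroˡ-≃ (F j) k≃0)
          , 𝕊.trans g≈ (coeffs λ j → *-zeroˡ-≃ (G j) k≃0))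
        cross : ∀ {t t′ T : Form} → t ≈ (λ j → k * T j) → t′ ≈ (λ j → l * T j) →
          ∀ j → k * t′ j ≃ l * t j
        cross {t} {t′} {T} t≈ t′≈ j = begin
          k * t′ j       ≈⟨ *-cong-≃ (≃-refl {k}) (at t′≈ j) ⟩
          k * (l * T j)  ≡⟨ swap k l (T j) ⟩
          l * (k * T j)  ≈⟨ *-cong-≃ (≃-refl {l}) (at t≈ j) ⟨
          l * t j        ∎
          where
          open ≃-Reasoning
          swap : ∀ k l t → k * (l * t) ≡ l * (k * t)
          swap = solve-∀

      x∂θ≈0 : x∂ f ≈ zeroF × x∂ g ≈ zeroF
      x∂θ≈0 =
        let k , l , k≄0 , eq-f , eq-g = proportional (suc (suc zero)) (Mem-x∂ m)
            k′ , l′ , k′≄0 , eq-f′ , eq-g′ = proportional zero (Mem-[1+x]∂ m)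
        in eigenvector-of-x∂-and-[1+x]∂ {l = l} {l′ = l′} k≄0 k′≄0 eq-f eq-f′ ,
           eigenvector-of-x∂-and-[1+x]∂ {l = l} {l′ = l′} k≄0 k′≄0 eq-g eq-g′

      f-∤ : ∀ i → ¬ p ∣ i → f i ≃ 0
      f-∤ = x∂≈0⇒∤ (proj₁ x∂θ≈0)

      g-∤ : ∀ i → ¬ p ∣ i → g i ≃ 0
      g-∤ = x∂≈0⇒∤ (proj₂ x∂θ≈0)

      x∂[f+g]≈0 : x∂ (addF f g) ≈ zeroF
      x∂[f+g]≈0 = coeffs λ i → ≃-trans (≃-reflexive (*-distribˡ-+ i (f i) (g i)))
        (+-zero-≃ (at (proj₁ x∂θ≈0) i) (at (proj₂ x∂θ≈0) i))

      quotient-equation : addF (λ i → c * Mem.C m i) ([1+x]∂ (Mem.C m)) ≈ zeroF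
      quotient-equation = x∂≈0⇒quotient c (Mem.C m) x∂[f+g]≈0 (Mem.sum m)

      -- Otherwise the coefficients of x^d vanish, and θ / y ∈ D(ζ − e₂).
      p∣d : p ∣ d
      p∣d with p ∣? d
      ... | yes p∣d = p∣d
      ... | no  p∤d = ⊥-elim (divide-by-y d refl)
        where
        open Mem m
        divide-by-y : ∀ e → e ≡ d → ⊥
        divide-by-y zero    refl = p∤d (p ∣0)
        divide-by-y (suc e) refl = no-member-below (suc zero) refl member nonzero
          where
          lower : ∀ {t} → (∀ i → ¬ p ∣ i → t i ≃ 0) → Deg 0 (suc e) t → Deg 0 e t
          lower t-∤ deg i e<i+0 with m≤n⇒m<n∨m≡n e<i+0
          ... | inj₁ 1+e<i+0 = deg i 1+e<i+0
          ... | inj₂ 1+e≡i+0 = t-∤ i (subst (¬_ ∘ (p ∣_)) (trans 1+e≡i+0 (+-identityʳ i)) p∤d)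
          lower-g : ∀ b → Deg b (suc e) g → Deg (b ∸ 1) e g
          lower-g zero    deg = lower g-∤ deg
          lower-g (suc b) deg = Deg-pred g deg
          member : Mem (subE (suc zero) ζ) e (f , g)
          member = record
            { low   = low
            ; deg-f = lower f-∤ deg-f
            ; deg-g = lower-g b deg-g
            ; C     = C
            ; deg-C = subst (λ k → Deg k e C) (+-identityʳ c)
                (Deg-[1+x]^⁻ c C (Deg-drop C deg-C) (Deg-resp-≈ sum
                  (Deg-+ (lower f-∤ deg-f) (lower g-∤ (Deg-drop g deg-g)))))
            ; sum   = sum
            }

      -- Otherwise the coefficient of x^a in f vanishes, and θ ∈ D(ζ + e₁).
      p∣a : p ∣ a
      p∣a with p ∣? a
      ... | yes p∣a = p∣a
      ... | no  p∤a = ⊥-elim (no-member-above zero {f , g} record { Mem m ; low = low′ } nonzero)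
        where
        low′ : Low (suc a) f
        low′ i i<1+a with m<1+n⇒m<n∨m≡n i<1+a
        ... | inj₁ i<a  = Mem.low m i i<a
        ... | inj₂ refl = f-∤ i p∤a

      -- Otherwise d - b is prime to p, since p ∣ d; the top coefficient of g vanishes and θ ∈ D(ζ +
      -- e₂).
      p∣b : p ∣ b
      p∣b with p ∣? b
      ... | yes p∣b = p∣b
      ... | no  p∤b = ⊥-elim
        (no-member-above (suc zero) {f , g} record { Mem m ; deg-g = deg-g′ } nonzero)
        where
        deg-g′ : Deg (suc b) d g
        deg-g′ i d<i+1+b with m<1+n⇒m<n∨m≡n (subst (d <_) (+-suc i b) d<i+1+b)
        ... | inj₁ d<i+b = Mem.deg-g m i d<i+b
        ... | inj₂ d≡i+b = g-∤ i (λ p∣i → p∤b (∣m+n∣m⇒∣n (subst (p ∣_) d≡i+b p∣d) p∣i))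

      -- Otherwise c θ ∈ D(ζ + e₃), because c C = −(1 + x) C′.
      p∣c : p ∣ c
      p∣c with p ∣? c
      ... | yes p∣c = p∣c
      ... | no  p∤c = ⊥-elim (no-member-above (suc (suc zero)) {cf , cg} member
          (λ (cf≈0 , cg≈0) → nonzero (cancel cf≈0 , cancel cg≈0)))
        where
        open Mem m
        cf cg K : Form
        cf i = c * f i
        cg i = c * g i
        K  i = -1ₚ * ∂ C i
        cancel : ∀ {t : Form} → (λ i → c * t i) ≈ zeroF → t ≈ zeroF
        cancel ct≈0 = coeffs λ i → *-≃0 (p∤c ∘ ≃0⇒∣) (at ct≈0 i)
        cC≈ : (λ i → c * C i) ≈ [1+x] K
        cC≈ = coeffs λ i → +-cancelˡ-≃ ([1+x]∂ C i) (begin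
          [1+x]∂ C i + c * C i            ≡⟨ +-comm ([1+x]∂ C i) (c * C i) ⟩
          c * C i + [1+x]∂ C i            ≈⟨ at quotient-equation i ⟩
          0                               ≈⟨ a-a≃0 ([1+x]∂ C i) ⟨
          [1+x]∂ C i + -1ₚ * [1+x]∂ C i
            ≈⟨ +-cong-≃ (≃-refl {[1+x]∂ C i})
                 (*-cong-≃ (≃-refl { -1ₚ}) (at ([1+x]∂≈[1+x][∂] C) i)) ⟩
          [1+x]∂ C i + -1ₚ * ([1+x] ∂ C) i
            ≈⟨ +-cong-≃ (≃-refl {[1+x]∂ C i}) (at ([1+x]^-scale 1 -1ₚ (∂ C)) i) ⟨
          [1+x]∂ C i + ([1+x] K) i        ∎)
          where open ≃-Reasoning
        member : Mem (addE (suc (suc zero)) ζ) d (cf , cg)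
        member = record
          { low   = λ i i<a → *-zeroʳ-≃ c (low i i<a)
          ; deg-f = Deg-scale c deg-f
          ; deg-g = Deg-scale c deg-g
          ; C     = K
          ; deg-C = Deg-scale -1ₚ λ i d<i+1+c →
              *-zeroʳ-≃ (suc i) (deg-C (suc i) (subst (d <_) (+-suc i c) d<i+1+c))
          ; sum   = begin
              addF cf cg                    ≈⟨ ≗⇒≈ (λ i → *-distribˡ-+ c (f i) (g i)) ⟨
              (λ i → c * addF f g i)        ≈⟨ coeffs (λ i → *-cong-≃ (≃-refl {c}) (at sum i)) ⟩
              (λ i → c * ([1+x]^ c · C) i)  ≈⟨ [1+x]^-scale c c C ⟨
              [1+x]^ c · (λ i → c * C i)    ≈⟨ [1+x]^-cong c cC≈ ⟩
              [1+x]^ c · ([1+x] K)          ≡⟨ [1+x]^-suc c K ⟨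
              [1+x]^ suc c · K              ∎
          }
          where open ≈-Reasoning

      x∂C≈0 : x∂ (Mem.C m) ≈ zeroF
      x∂C≈0 = [1+x]∂≈0⇒x∂≈0 (coeffs λ i →
        +-≃0ˡ (*-zeroˡ-≃ (Mem.C m i) (∣⇒≃0 p∣c)) (at quotient-equation i))

      deflated-Δ : ∀ a′ b′ c′ d′ → a ≡ a′ * p → b ≡ b′ * p → c ≡ c′ * p → d ≡ d′ * p →
        Δ (a , b , c) ≤ p * Δ (a′ , b′ , c′)
      deflated-Δ a′ b′ c′ d′ refl refl refl refl = +-cancelˡ-≤ (2 * d) _ _ (begin
        2 * d + Δ ζ                  ≡⟨ eq ⟩
        ∣ ζ ∣                        ≡⟨ factor p a′ b′ c′ ⟩
        p * ∣ ν ∣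
          ≤⟨ *-monoʳ-≤ p (∣∣≤2d+Δ (Mem-deflate {d = d′} m x∂C≈0) nonzero′) ⟩
        p * (2 * d′ + Δ ν)           ≡⟨ distrib p d′ (Δ ν) ⟩
        2 * d + p * Δ ν              ∎)
        where
        open ≤-Reasoning
        ν : Λ
        ν = a′ , b′ , c′
        factor : ∀ p a b c → a * p + b * p + c * p ≡ p * (a + b + c)
        factor = solve-∀
        distrib : ∀ p d n → p * (2 * d + n) ≡ 2 * (d * p) + p * n
        distrib = solve-∀
        inflate-zero : ∀ {t} → x∂ t ≈ zeroF → deflate t ≈ zeroF → t ≈ zeroF
        inflate-zero {t} x∂t≈0 t′≈0 = 𝕊.trans (inflate-deflate x∂t≈0)
          (coeffs λ i → inflate-vanish {deflate t} (λ q _ → at t′≈0 q))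
        nonzero′ : NonZ (deflate f , deflate g)
        nonzero′ (f′≈0 , g′≈0) =
          nonzero (inflate-zero (proj₁ x∂θ≈0) f′≈0 , inflate-zero (proj₂ x∂θ≈0) g′≈0)

      deflated-peak : Σ[ ν ∈ Λ ] (ζ ≡ scale p ν × Δ ζ ≤ p * Δ ν)
      deflated-peak with p∣a | p∣b | p∣c | p∣d
      ... | divides a′ a≡ | divides b′ b≡ | divides c′ c≡ | divides d′ d≡ =
        (a′ , b′ , c′) ,
        cong₂ _,_ (trans a≡ (*-comm a′ p))
          (cong₂ _,_ (trans b≡ (*-comm b′ p)) (trans c≡ (*-comm c′ p))) ,
        deflated-Δ a′ b′ c′ d′ a≡ b≡ c≡ d≡

    -- Growth of Δ, ascent to peaks and descent by p

    Δ-Lipschitz : ∀ n {μ τ} → dist μ τ ≡ n → Δ τ ≤ Δ μ + n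
    Δ-Lipschitz n {μ} {τ} eq with step-towards μ τ
    ... | inj₁ refl = m≤m+n (Δ μ) n
    Δ-Lipschitz zero    eq | inj₂ (ν , adj , closer) with trans (sym closer) eq
    ... | ()
    Δ-Lipschitz (suc n) {μ} {τ} eq | inj₂ (ν , adj , closer) = begin
      Δ τ              ≤⟨ Δ-Lipschitz n (suc-injective (trans (sym closer) eq)) ⟩
      Δ ν + n          ≤⟨ +-monoˡ-≤ n (Δ-adjacent-≤ (Adjacent-sym adj)) ⟩
      suc (Δ μ) + n    ≡⟨ +-suc (Δ μ) n ⟨
      Δ μ + suc n      ∎
      where open ≤-Reasoning

    -- The first step of a path away from a peak loses 1 where the Lipschitz bound allows a gain of
    -- 1, whence the 2.
    Δ-from-peak : ∀ {ζ} τ → Peak ζ → ζ ≡ τ ⊎ 2 + Δ τ ≤ Δ ζ + dist ζ τ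
    Δ-from-peak {ζ} τ peak with step-towards ζ τ
    ... | inj₁ ζ≡τ = inj₁ ζ≡τ
    ... | inj₂ (ν , adj , closer) = inj₂ (begin
      2 + Δ τ                    ≤⟨ +-monoʳ-≤ 2 (Δ-Lipschitz (dist ν τ) refl) ⟩
      2 + (Δ ν + dist ν τ)       ≡⟨ cong suc (+-suc (Δ ν) (dist ν τ)) ⟨
      suc (Δ ν) + suc (dist ν τ) ≤⟨ +-mono-≤ (peak ν adj) (≤-reflexive (sym closer)) ⟩
      Δ ζ + dist ζ τ             ∎)
      where open ≤-Reasoning

    -- For balanced μ, members of degree below some μᵢ vanish, so the least degree d is at least
    -- every μᵢ; and ∣μ∣ = 2d + Δ μ.
    balanced-bounds : ∀ μ → Balanced μ →
      2 * μ₁ μ + Δ μ ≤ ∣ μ ∣ × 2 * μ₂ μ + Δ μ ≤ ∣ μ ∣ × 2 * μ₃ μ + Δ μ ≤ ∣ μ ∣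
    balanced-bounds μ@(a , b , c) (ba , bb , bc) with minimal-member (isΔ μ)
    ... | d , θ , m , nonzero , eq =
      bound a≤d , bound b≤d , bound c≤d
      where
      bound : ∀ {x} → x ≤ d → 2 * x + Δ μ ≤ ∣ μ ∣
      bound x≤d = ≤-trans (+-monoˡ-≤ (Δ μ) (*-monoʳ-≤ 2 x≤d)) (≤-reflexive eq)
      rest : ∀ x y → 2 * x ≤ x + y → x ≤ y
      rest x y 2x≤x+y = +-cancelˡ-≤ x x y (subst (_≤ x + y) (cong (x +_) (+-identityʳ x)) 2x≤x+y)
      a≤d : a ≤ d
      a≤d = ≮⇒≥ λ d<a → nonzero (Mem-small₁ m d<a (<-≤-trans d<a
        (rest a (b + c) (subst (2 * a ≤_) (+-assoc a b c) ba))))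
      b≤d : b ≤ d
      b≤d = ≮⇒≥ λ d<b → nonzero (Mem-small₂ m d<b (<-≤-trans d<b
        (rest b (a + c) (subst (2 * b ≤_) (perm a b c) bb))))
        where
        perm : ∀ a b c → a + b + c ≡ b + (a + c)
        perm = solve-∀
      c≤d : c ≤ d
      c≤d = ≮⇒≥ λ d<c → nonzero (Mem-small₃ m d<c (<-≤-trans d<c
        (rest c (a + b) (subst (2 * c ≤_) (+-comm (a + b) c) bc))))

    -- A positive Δ makes the balance inequalities strict, by `balanced-bounds`. The climb thus
    -- never leaves the balanced region.
    Balanced-adjacent : ∀ {μ ν} → Balanced μ → 0 < Δ μ → Adjacent μ ν → Balanced ν
    Balanced-adjacent {μ} {ν} balanced 0<Δ = go
      where
      strict : StrictlyBalanced μ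
      strict with balanced-bounds μ balanced
      ... | ba , bb , bc = sharpen ba , sharpen bb , sharpen bc
        where
        sharpen : ∀ {x} → x + Δ μ ≤ ∣ μ ∣ → x < ∣ μ ∣
        sharpen {x} = ≤-trans (m<m+n x 0<Δ)
      go : Adjacent μ ν → Balanced ν
      go (i , inj₁ refl) = StrictlyBalanced-addE⇒Balanced i ν strict
      go (i , inj₂ refl) = StrictlyBalanced⇒Balanced-addE i μ strict

    3Δ≤∣∣ : ∀ μ → Balanced μ → 3 * Δ μ ≤ ∣ μ ∣
    3Δ≤∣∣ μ@(a , b , c) balanced with balanced-bounds μ balanced
    ... | ba , bb , bc = +-cancelˡ-≤ (2 * ∣ μ ∣) _ _ (begin
      2 * ∣ μ ∣ + 3 * Δ μ                                    ≡⟨ split a b c (Δ μ) ⟩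
      (2 * a + Δ μ) + (2 * b + Δ μ) + (2 * c + Δ μ)          ≤⟨ +-mono-≤ (+-mono-≤ ba bb) bc ⟩
      ∣ μ ∣ + ∣ μ ∣ + ∣ μ ∣                                  ≡⟨ triple ∣ μ ∣ ⟩
      2 * ∣ μ ∣ + ∣ μ ∣                                      ∎)
      where
      open ≤-Reasoning
      split : ∀ a b c n → 2 * (a + b + c) + 3 * n ≡ (2 * a + n) + (2 * b + n) + (2 * c + n)
      split = solve-∀
      triple : ∀ s → s + s + s ≡ 2 * s + s
      triple = solve-∀

    higher-neighbour-or-peak : ∀ μ → (Σ[ ν ∈ Λ ] (Adjacent μ ν × Δ μ < Δ ν)) ⊎ Peak μ
    higher-neighbour-or-peak μ
      with any? (λ i → (Δ μ <? Δ (addE i μ)) ⊎-dec (Δ μ <? Δ (subE i μ)))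
    ... | yes (i , inj₁ up) = inj₁ (addE i μ , (i , inj₂ refl) , up)
    ... | yes (i , inj₂ up) with subE-cases i μ
    ...   | inj₁ eq = inj₁ (subE i μ , (i , inj₁ eq) , up)
    ...   | inj₂ eq = ⊥-elim (<-irrefl (cong Δ (sym eq)) up)
    higher-neighbour-or-peak μ | no none = inj₂ peak
      where
      strict : ∀ {ν} → Adjacent μ ν → ¬ Δ μ < Δ ν → Δ ν < Δ μ
      strict adj ≮ = ≤∧≢⇒< (≮⇒≥ ≮) (Δ-adjacent-≢ (Adjacent-sym adj))
      peak : Peak μ
      peak ν adj@(i , inj₁ refl) = strict adj
        (λ up → none (i , inj₂ (subst (λ τ → Δ μ < Δ τ) (sym (subE-addE i ν)) up)))
      peak ν adj@(i , inj₂ refl) = strict adj (λ up → none (i , inj₁ up))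

    -- Terminates because a step raises Δ by 1 and ∣ μ ∣ by at most 1, while
    -- 3 Δ ≤ ∣ μ ∣ persists.
    climb : ∀ n {μ} → Balanced μ → 0 < Δ μ → ∣ μ ∣ ≤ 2 * n + 3 * Δ μ →
      Σ[ ζ ∈ Λ ] (Balanced ζ × Peak ζ × dist μ ζ + Δ μ ≤ Δ ζ)
    climb n {μ} balanced 0<Δ fuel with higher-neighbour-or-peak μ
    ... | inj₂ peak = μ , balanced , peak , ≤-reflexive (cong (_+ Δ μ) (dist-refl μ))
      where
      dist-refl : ∀ μ → dist μ μ ≡ 0
      dist-refl (a , b , c) rewrite ∣n-n∣≡0 a | ∣n-n∣≡0 b | ∣n-n∣≡0 c = refl
    ... | inj₁ (ν , adj , up) = continue n fuel
      where
      open ≤-Reasoning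
      balanced-ν : Balanced ν
      balanced-ν = Balanced-adjacent balanced 0<Δ adj
      ∣∣-adjacent : ∀ {ν} → Adjacent μ ν → ∣ ν ∣ ≤ suc ∣ μ ∣
      ∣∣-adjacent {ν} (i , inj₁ refl) =
        m≤n⇒m≤1+n (≤-trans (n≤1+n ∣ ν ∣) (≤-reflexive (sym (∣addE∣ i ν))))
      ∣∣-adjacent     (i , inj₂ refl) = ≤-reflexive (∣addE∣ i μ)
      continue : ∀ n → ∣ μ ∣ ≤ 2 * n + 3 * Δ μ →
        Σ[ ζ ∈ Λ ] (Balanced ζ × Peak ζ × dist μ ζ + Δ μ ≤ Δ ζ)
      continue zero fuel = ⊥-elim (<-irrefl refl (begin-strict
        suc (3 * Δ μ)   <⟨ s<s (m<n+m (3 * Δ μ) {2} z<s) ⟩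
        3 + 3 * Δ μ     ≡⟨ *-suc 3 (Δ μ) ⟨
        3 * suc (Δ μ)   ≤⟨ *-monoʳ-≤ 3 up ⟩
        3 * Δ ν         ≤⟨ 3Δ≤∣∣ ν balanced-ν ⟩
        ∣ ν ∣           ≤⟨ ∣∣-adjacent adj ⟩
        suc ∣ μ ∣       ≤⟨ s≤s fuel ⟩
        suc (3 * Δ μ)   ∎))
      -- Each step raises 3 Δ - ∣μ∣ by at least 3 - 1, which is why the fuel counts twice.
      continue (suc n) fuel with climb n balanced-ν (≤-<-trans z≤n up) (begin
        ∣ ν ∣                          ≤⟨ ∣∣-adjacent adj ⟩
        suc ∣ μ ∣                      ≤⟨ s≤s fuel ⟩
        suc (2 * suc n + 3 * Δ μ)      ≡⟨ regroup n (Δ μ) ⟩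
        2 * n + 3 * suc (Δ μ)          ≤⟨ +-monoʳ-≤ (2 * n) (*-monoʳ-≤ 3 up) ⟩
        2 * n + 3 * Δ ν                ∎)
        where
        regroup : ∀ n d → suc (2 * suc n + 3 * d) ≡ 2 * n + 3 * suc d
        regroup = solve-∀
      ... | ζ , balanced-ζ , peak , ascent = ζ , balanced-ζ , peak , (begin
        dist μ ζ + Δ μ                 ≤⟨ +-monoˡ-≤ (Δ μ) (dist-triangle μ ν ζ) ⟩
        dist μ ν + dist ν ζ + Δ μ      ≡⟨ cong (λ k → k + dist ν ζ + Δ μ) (dist-adjacent adj) ⟩
        suc (dist ν ζ + Δ μ)           ≡⟨ +-suc (dist ν ζ) (Δ μ) ⟨
        dist ν ζ + suc (Δ μ)           ≤⟨ +-monoʳ-≤ (dist ν ζ) up ⟩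
        dist ν ζ + Δ ν                 ≤⟨ ascent ⟩
        Δ ζ                            ∎)

    Δ≡1⇒Odd : ∀ {μ} → Δ μ ≡ 1 → Odd ∣ μ ∣
    Δ≡1⇒Odd {μ} Δ≡1 with minimal-member (isΔ μ)
    ... | d , _ , _ , _ , eq =
      d , trans (sym eq) (trans (cong (2 * d +_) Δ≡1) (+-comm (2 * d) 1))

    Odd⇒0<Δ : ∀ {μ} → Odd ∣ μ ∣ → 0 < Δ μ
    Odd⇒0<Δ {μ} (k , odd) with minimal-member (isΔ μ)
    ... | d , _ , _ , _ , eq = n≢0⇒n>0 λ Δ≡0 → even≢odd d k
      (trans (sym (+-identityʳ (2 * d))) (trans (cong (2 * d +_) (sym Δ≡0)) (trans eq odd)))

    Balanced-unscale : ∀ ν → Balanced (scale p ν) → Balanced ν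
    Balanced-unscale ν@(a , b , c) (ba , bb , bc) = unscale ba , unscale bb , unscale bc
      where
      swap-factor : ∀ k x → 2 * (k * x) ≡ k * (2 * x)
      swap-factor = solve-∀
      unscale : ∀ {x} → 2 * (p * x) ≤ ∣ scale p ν ∣ → 2 * x ≤ ∣ ν ∣
      unscale {x} le = *-cancelˡ-≤ p (begin
        p * (2 * x)      ≡⟨ swap-factor p x ⟨
        2 * (p * x)      ≤⟨ le ⟩
        ∣ scale p ν ∣    ≡⟨ ∣scale∣ p ν ⟩
        p * ∣ ν ∣        ∎)
        where open ≤-Reasoning

    -- A higher neighbour ν′ of ν would give Δ(p ν′) ≥ p Δ(ν) + p at distance p from p ν. That is
    -- growth by 1 in every step, impossible when starting from a peak.
    Peak-unscale : ∀ ν → Peak (scale p ν) → Δ (scale p ν) ≡ p * Δ ν → Peak ν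
    Peak-unscale ν peak Δ≡ ν′ adj = ≰⇒> λ Δν≤Δν′ →
      let Δν<Δν′ = ≤∧≢⇒< Δν≤Δν′ (Δ-adjacent-≢ adj) in
      [ (λ same → <⇒≱ Δν<Δν′ (*-cancelˡ-≤ p (begin
          p * Δ ν′           ≤⟨ p*Δ≤Δ-scale ν′ ⟩
          Δ (scale p ν′)     ≡⟨ cong Δ same ⟨
          Δ (scale p ν)      ≡⟨ Δ≡ ⟩
          p * Δ ν            ∎)))
      , (λ low → <-irrefl refl (begin-strict
          Δ (scale p ν′)                                      <⟨ m<n+m (Δ (scale p ν′)) z<s ⟩
          2 + Δ (scale p ν′)                                  ≤⟨ low ⟩
          Δ (scale p ν) + dist (scale p ν) (scale p ν′)
            ≡⟨ cong₂ _+_ Δ≡ (trans (dist-scale p ν ν′)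
                 (trans (cong (p *_) (dist-adjacent adj)) (*-identityʳ p))) ⟩
          p * Δ ν + p                                         ≡⟨ +-comm (p * Δ ν) p ⟩
          p + p * Δ ν                                         ≡⟨ *-suc p (Δ ν) ⟨
          p * suc (Δ ν)                                       ≤⟨ *-monoʳ-≤ p Δν<Δν′ ⟩
          p * Δ ν′                                            ≤⟨ p*Δ≤Δ-scale ν′ ⟩
          Δ (scale p ν′)                                      ∎))
      ]′ (Δ-from-peak (scale p ν′) peak)
      where open ≤-Reasoning

    -- The bound n on the height is the measure of the descent: Δ ν < p Δ ν = Δ ζ. It stops at
    -- height 1, where parity makes the size odd.
    balanced-peak : ∀ n {ζ} → Δ ζ ≤ n → 0 < Δ ζ → Balanced ζ → Peak ζ →
      Σ[ k ∈ ℕ ] Σ[ ν ∈ Λ ] (ζ ≡ scale (p ^ k) ν × Δ ζ ≡ p ^ k × BalOdd ν)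
    balanced-peak zero    Δ≤0 0<Δ = ⊥-elim (<⇒≱ 0<Δ Δ≤0)
    balanced-peak (suc n) {ζ} Δ≤1+n 0<Δ balanced peak with Δ ζ ≟ 1
    ... | yes Δ≡1 = 0 , ζ , sym (scale-1 ζ) , Δ≡1 , balanced , Δ≡1⇒Odd Δ≡1
    ... | no  Δ≢1 with minimal-member (isΔ ζ)
    ...   | d , _ , m , nonzero , eq with deflated-peak peak (≤∧≢⇒< 0<Δ (Δ≢1 ∘ sym)) m nonzero eq
    ...   | ν , refl , Δ≤pΔ
      with balanced-peak n Δν≤n 0<Δν (Balanced-unscale ν balanced) (Peak-unscale ν peak Δ≡)
      where
      Δ≡ : Δ (scale p ν) ≡ p * Δ ν
      Δ≡ = ≤-antisym Δ≤pΔ (p*Δ≤Δ-scale ν)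
      0<Δν : 0 < Δ ν
      0<Δν = n≢0⇒n>0 λ Δν≡0 → <⇒≢ 0<Δ (sym (trans Δ≡ (trans (cong (p *_) Δν≡0) (*-zeroʳ p))))
      Δν≤n : Δ ν ≤ n
      Δν≤n = ≤-pred (≤-trans (subst (Δ ν <_) (trans (*-comm (Δ ν) p) (sym Δ≡))
        (m<m*n (Δ ν) p {{>-nonZero 0<Δν}} 1<p)) Δ≤1+n)
    ...   | k , ν′ , refl , Δν≡ , balOdd =
      suc k , ν′ , sym (scale-* p (p ^ k) ν′) ,
      trans (≤-antisym Δ≤pΔ (p*Δ≤Δ-scale ν)) (cong (p *_) Δν≡) , balOdd

    p^m*Δ≤Δ-scale : ∀ m ν → p ^ m * Δ ν ≤ Δ (scale (p ^ m) ν)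
    p^m*Δ≤Δ-scale zero    ν = ≤-reflexive (trans (*-identityˡ (Δ ν)) (cong Δ (sym (scale-1 ν))))
    p^m*Δ≤Δ-scale (suc m) ν = begin
      p * p ^ m * Δ ν                  ≡⟨ *-assoc p (p ^ m) (Δ ν) ⟩
      p * (p ^ m * Δ ν)                ≤⟨ *-monoʳ-≤ p (p^m*Δ≤Δ-scale m ν) ⟩
      p * Δ (scale (p ^ m) ν)          ≤⟨ p*Δ≤Δ-scale (scale (p ^ m) ν) ⟩
      Δ (scale p (scale (p ^ m) ν))    ≡⟨ cong Δ (scale-* p (p ^ m) ν) ⟨
      Δ (scale (p * p ^ m) ν)          ∎
      where open ≤-Reasoning

    1<p^m : ∀ {m} → 0 < m → 1 < p ^ m
    1<p^m {suc m} _ = ≤-trans 1<p (m≤m*n p (p ^ m) {{m^n≢0 p m}})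

    -- The two inclusions

    InZ1⇒InRHS : ∀ {μ} → InZ1 Δ μ → InRHS p μ
    InZ1⇒InRHS {μ} ((balanced , _ , peak) , Δ≡1) = (balanced , Δ≡1⇒Odd Δ≡1) , outside
      where
      open ≤-Reasoning
      outside : ¬ (Σ[ m ∈ ℕ ] Σ[ ν ∈ Λ ] (0 < m × BalOdd ν × dist μ (scale (p ^ m) ν) < p ^ m))
      outside (m , ν , 0<m , (_ , odd) , near) =
        [ (λ same → <⇒≱ (1<p^m 0<m) (begin
            p ^ m     ≤⟨ p^m≤Δ ⟩
            Δ τ       ≡⟨ cong Δ same ⟨
            Δ μ       ≡⟨ Δ≡1 ⟩
            1         ∎))
        -- A peak of height 1 allows Δ τ at most dist μ τ - 1, while the ball gives dist μ τ < p^m ≤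
        -- Δ τ.
        , (λ low → <-irrefl refl (begin-strict
            p ^ m             ≤⟨ p^m≤Δ ⟩
            Δ τ               <⟨ m<n+m (Δ τ) z<s ⟩
            2 + Δ τ           ≤⟨ low ⟩
            Δ μ + dist μ τ    ≡⟨ cong (_+ dist μ τ) Δ≡1 ⟩
            suc (dist μ τ)    ≤⟨ near ⟩
            p ^ m             ∎))
        ]′ (Δ-from-peak τ peak)
        where
        τ : Λ
        τ = scale (p ^ m) ν
        p^m≤Δ : p ^ m ≤ Δ τ
        p^m≤Δ = ≤-trans (m≤m*n (p ^ m) (Δ ν) {{>-nonZero (Odd⇒0<Δ odd)}}) (p^m*Δ≤Δ-scale m ν)

    InRHS⇒InZ1 : ∀ {μ} → InRHS p μ → InZ1 Δ μ
    InRHS⇒InZ1 {μ} ((balanced , odd) , outside)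
      with climb ∣ μ ∣ balanced 0<Δ (≤-trans (m≤m+n ∣ μ ∣ (1 * ∣ μ ∣))
             (m≤m+n (2 * ∣ μ ∣) (3 * Δ μ)))
      where
      0<Δ : 0 < Δ μ
      0<Δ = Odd⇒0<Δ odd
    ... | ζ , balanced-ζ , peak , ascent
      with balanced-peak (Δ ζ) ≤-refl
             (≤-trans (≤-trans (Odd⇒0<Δ odd) (m≤n+m (Δ μ) (dist μ ζ))) ascent) balanced-ζ peak
    ... | suc k , ν , refl , Δζ≡ , balOdd = ⊥-elim (outside
      (suc k , ν , z<s , balOdd , (begin-strict
      dist μ ζ          <⟨ m<m+n (dist μ ζ) (Odd⇒0<Δ odd) ⟩
      dist μ ζ + Δ μ    ≤⟨ ascent ⟩
      Δ ζ               ≡⟨ Δζ≡ ⟩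
      p ^ suc k         ∎)))
      where open ≤-Reasoning
    ... | zero , _ , _ , Δζ≡1 , _ with step-towards μ ζ
    ...   | inj₁ refl = (balanced , Odd⇒0<Δ odd , peak) , Δζ≡1
    -- Height 1 leaves no room for a climb: dist μ ζ + Δ μ ≤ 1 and Δ μ ≥ 1 force μ = ζ.
    ...   | inj₂ (_ , _ , closer) = ⊥-elim (<-irrefl refl (begin-strict
      1                 <⟨ +-mono-≤ (≤-trans (s≤s z≤n) (≤-reflexive (sym closer))) (Odd⇒0<Δ odd) ⟩
      dist μ ζ + Δ μ    ≤⟨ ascent ⟩
      Δ ζ               ≡⟨ Δζ≡1 ⟩
      1                 ∎))
      where open ≤-Reasoning

theorem3p2 : (p : ℕ) → .{{_ : NonZero p}} → Prime p →
    (Δ : Λ → ℕ) → (∀ μ → IsΔ p μ (Δ μ)) →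
    ∀ μ → (InZ1 Δ μ → InRHS p μ) × (InRHS p μ → InZ1 Δ μ)
theorem3p2 p p-prime Δ isΔ μ = InZ1⇒InRHS , InRHS⇒InZ1
  where open ModPrime.Peaks p p-prime Δ isΔ
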